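{- For every integer $n\ge 1$, each of the triples of statistics $(\mathrm{rlm},\mathrm{w\overline{m}},\mathrm{asc})$ and $(\mathrm{rlm},\mathrm{rlmin},\mathrm{asc})$ is equally distributed with the triple $(\mathrm{rlmax}-1,\mathrm{rlmin},\mathrm{asc})$ on $S_n$.
   Context: $S_n$ is the set of permutations $\pi=\pi_1\pi_2\cdots\pi_n$ of $[n]=\{1,\dots,n\}$. Statistics. For a word $w=w_1\cdots w_m$ of distinct integers, $w_i$ is an RL-maximum if $w_i>w_j$ for all $j>i$, and an RL-minimum if $w_i<w_j$ for all $j>i$; $\mathrm{rlmax}(w)$ and $\mathrm{rlmin}(w)$ are the numbers of RL-maxima and RL-minima of $w$. For $\pi\in S_n$, $\mathrm{rlm}(\pi)$ is the number of RL-maxima of the (possibly empty) subword of $\pi$ consisting of the letters to the left of the letter $1$. An index $i$ is a weak excedance of $\pi$ if $\pi_i\ge i$; it is a mid-point of $\pi$ if there exist $j<i<k$ with $\pi_j>\pi_i>\pi_k$, and a non-mid-point otherwise. $\mathrm{w\overline{m}}(\pi)$ is the number of indices $i$ that are both a weak excedance and a non-mid-point of $\pi$. $\mathrm{asc}(\pi)$ is the number of $i\in[n-1]$ with $\pi_i<\pi_{i+1}$. Two tuples of statistics $(f_1,\dots,f_k)$ and $(g_1,\dots,g_k)$ are equally distributed on a finite set $X$ if for every tuple of values $(a_1,\dots,a_k)$ the number of $x\in X$ with $(f_1(x),\dots,f_k(x))=(a_1,\dots,a_k)$ equals the number of $x\in X$ with $(g_1(x),\dots,g_k(x))=(a_1,\dots,a_k)$.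 -}

module Defs where

open import Data.Fin.Base as Fin using (Fin; toℕ)
import Data.Fin.Properties as Fin
open import Data.List.Base using (List; []; _∷_; _++_; length; lookup; map; filter; takeWhile; upTo; allFin; cartesianProductWith)
open import Data.List.Membership.DecPropositional using (_∈?_)
open import Data.List.Membership.Propositional using (_∈_)
open import Data.List.Membership.Propositional.Properties using (∈-∃++; ∈-filter⁺; ∈-filter⁻; ∈-cartesianProductWith⁺)
open import Data.List.Properties using (∷-injective; length-map; length-upTo)
open import Data.List.Relation.Binary.Permutation.Propositional using (_↭_; ↭-refl; ↭-sym; ↭-trans; prep)
open import Data.List.Relation.Binary.Permutation.Propositional.Properties using (↭-length; ∈-resp-↭; drop-∷; shift)
open import Data.List.Relation.Unary.All as All using (All; []; _∷_)
open import Data.List.Relation.Unary.AllPairs using ([]; _∷_)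
open import Data.List.Relation.Unary.Any using (here)
open import Data.List.Relation.Unary.Unique.Propositional using (Unique)
import Data.List.Relation.Unary.Unique.Propositional.Properties as Unique
open import Data.Nat.Base using (ℕ; zero; suc; _∸_; _<_; _≤_; _>_)
open import Data.Nat.Properties using (_≟_; _<?_; _≤?_; suc-injective)
open import Data.Product.Base using (_×_; _,_; proj₂; ∃-syntax)
open import Data.Vec.Base as Vec using (Vec)
open import Data.Vec.Properties using (≡-dec)
open import Function.Base using (_∘_)
open import Function.Bundles using (_⇔_; mk⇔)
open import Relation.Binary.PropositionalEquality using (_≡_; refl; sym; trans; subst)
open import Relation.Nullary using (Dec; yes; no; ¬_; ¬?; _×-dec_; _→-dec_)
open import Relation.Nullary.Decidable using (map′)
open import Relation.Unary using (Decidable)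

-- Words are lists of natural numbers.  A position i : Fin (length w) is
-- 0-based, so it stands for the index suc (toℕ i) of the mathematical text;
-- letters are not shifted.

Word : Set
Word = List ℕ

count : {A : Set} {P : A → Set} → Decidable P → List A → ℕ
count P? xs = length (filter P? xs)

#positions : (w : Word) {P : Fin (length w) → Set} → Decidable P → ℕ
#positions w P? = count P? (allFin (length w))

IsRLMax : (w : Word) → Fin (length w) → Set
IsRLMax w i = ∀ j → i Fin.< j → lookup w i > lookup w j

IsRLMin : (w : Word) → Fin (length w) → Set
IsRLMin w i = ∀ j → i Fin.< j → lookup w i < lookup w j

IsWeakExcedance : (w : Word) → Fin (length w) → Set
IsWeakExcedance w i = suc (toℕ i) ≤ lookup w i

IsMidPoint : (w : Word) → Fin (length w) → Set
IsMidPoint w i = ∃[ j ] ∃[ k ] (j Fin.< i × i Fin.< k × lookup w j > lookup w i × lookup w i > lookup w k)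

-- The last position has no successor, so it is never an ascent.
IsAscent : (w : Word) → Fin (length w) → Set
IsAscent w i = ∃[ j ] (toℕ j ≡ suc (toℕ i) × lookup w i < lookup w j)

isRLMax? : ∀ w → Decidable (IsRLMax w)
isRLMax? w i = Fin.all? λ j → (i Fin.<? j) →-dec (lookup w j <? lookup w i)

isRLMin? : ∀ w → Decidable (IsRLMin w)
isRLMin? w i = Fin.all? λ j → (i Fin.<? j) →-dec (lookup w i <? lookup w j)

isWeakExcedance? : ∀ w → Decidable (IsWeakExcedance w)
isWeakExcedance? w i = suc (toℕ i) ≤? lookup w i

isMidPoint? : ∀ w → Decidable (IsMidPoint w)
isMidPoint? w i = Fin.any? λ j → Fin.any? λ k →
  (j Fin.<? i) ×-dec (i Fin.<? k) ×-dec (lookup w i <? lookup w j) ×-dec (lookup w k <? lookup w i)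

isAscent? : ∀ w → Decidable (IsAscent w)
isAscent? w i = Fin.any? λ j → (toℕ j ≟ suc (toℕ i)) ×-dec (lookup w i <? lookup w j)

rlmax : Word → ℕ
rlmax w = #positions w (isRLMax? w)

rlmin : Word → ℕ
rlmin w = #positions w (isRLMin? w)

asc : Word → ℕ
asc w = #positions w (isAscent? w)

-- The statistic written as w followed by m with an overline.
wnm : Word → ℕ
wnm w = #positions w λ i → isWeakExcedance? w i ×-dec ¬? (isMidPoint? w i)

leftOf1 : Word → Word
leftOf1 = takeWhile λ x → ¬? (x ≟ 1)

rlm : Word → ℕ
rlm w = rlmax (leftOf1 w)

-- A nonempty word has an RL-maximum (its last letter), so the subtraction is
-- not truncated on permutations of [n] with n ≥ 1.
rlmax-1 : Word → ℕ
rlmax-1 w = rlmax w ∸ 1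

[1⋯_] : ℕ → Word
[1⋯ n ] = map suc (upTo n)

IsPermutation : ℕ → Word → Set
IsPermutation n w = w ↭ [1⋯ n ]

_↭?_ : (u v : Word) → Dec (u ↭ v)
[] ↭? [] = yes ↭-refl
[] ↭? (y ∷ v) = no λ p → case-length (↭-length p)
  where
  case-length : ∀ {m} → ¬ (zero ≡ suc m)
  case-length ()
(x ∷ u) ↭? v with _∈?_ _≟_ x v
... | no x∉v = no λ p → x∉v (∈-resp-↭ p (here refl))
... | yes x∈v with ∈-∃++ x∈v
...   | ys , zs , refl = map′
        (λ p → ↭-trans (prep x p) (↭-sym (shift x ys zs)))
        (λ p → drop-∷ (↭-trans p (shift x ys zs)))
        (u ↭? (ys ++ zs))

words : List ℕ → ℕ → List Word
words A zero    = [] ∷ []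
words A (suc m) = cartesianProductWith _∷_ A (words A m)

S : ℕ → List Word
S n = filter (_↭? [1⋯ n ]) (words [1⋯ n ] n)

-- S n lists every permutation of [n] exactly once, so counting in S n is
-- counting permutations.

∈-words : ∀ {A} w → All (_∈ A) w → w ∈ words A (length w)
∈-words []      []       = here refl
∈-words (x ∷ w) (p ∷ ps) = ∈-cartesianProductWith⁺ _∷_ p (∈-words w ps)

words-unique : ∀ {A} → Unique A → ∀ m → Unique (words A m)
words-unique A! zero    = [] ∷ []
words-unique A! (suc m) = Unique.cartesianProductWith⁺ _∷_ ∷-injective A! (words-unique A! m)

length-[1⋯] : ∀ n → length [1⋯ n ] ≡ n
length-[1⋯] n = trans (length-map suc (upTo n)) (length-upTo n)

∈-S : ∀ n w → w ∈ S n ⇔ IsPermutation n w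
∈-S n w = mk⇔
  (λ w∈S → proj₂ (∈-filter⁻ (_↭? [1⋯ n ]) {xs = words [1⋯ n ] n} w∈S))
  (λ p → ∈-filter⁺ (_↭? [1⋯ n ])
    (subst (λ m → w ∈ words [1⋯ n ] m) (trans (↭-length p) (length-[1⋯] n))
      (∈-words w (All.tabulate (∈-resp-↭ p))))
    p)

S-unique : ∀ n → Unique (S n)
S-unique n = Unique.filter⁺ (_↭? [1⋯ n ]) (words-unique (Unique.map⁺ suc-injective (Unique.upTo⁺ n)) n)

values : {A : Set} {k : ℕ} → Vec (A → ℕ) k → A → Vec ℕ k
values fs x = Vec.map (λ f → f x) fs

-- The list X is meant to enumerate a finite set without repetition.
EquallyDistributed : {A : Set} {k : ℕ} → List A → (fs gs : Vec (A → ℕ) k) → Set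
EquallyDistributed {k = k} X fs gs =
  (a : Vec ℕ k) → count (λ x → ≡-dec _≟_ (values fs x) a) X ≡ count (λ x → ≡-dec _≟_ (values gs x) a) X

{-# OPTIONS --safe #-}

-- All three triples are compared with (rlm, 1 + lrmax R, asc), where π = L 1 R
-- and lrmax counts left-to-right maxima.
--
-- (rlm, wnm, asc): on a permutation a weak excedance is a non-mid-point exactly
-- if it is a left-to-right maximum.  Let m be the largest letter of L = A m C
-- and write R = B D, where B is the longest prefix with letters below m.  The
-- involution A m C 1 B D ↔ B m C 1 A D does the rest.
--
-- (rlm, rlmin, asc): replace R by its reverse complement within its letters.
--
-- (rlmax - 1, rlmin, asc): build a permutation from right to left, each new
-- letter renumbering the others.  A new letter is a right-to-left maximum if it
-- is the largest, a right-to-left minimum if it is the smallest, and otherwise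
-- only its comparison with the previous letter matters.  Simultaneously build a
-- second permutation u: a largest letter is put in front of u, a smallest one
-- is replaced by a new largest letter at the end of u, and an intermediate one
-- v is inserted with the same value, in front of u if the maximum of u precedes
-- 1, and immediately after the maximum otherwise.

module Submission where

open import Defs
open import Data.Fin.Base as Fin using (Fin; zero; suc; toℕ)
import Data.Fin.Properties as Fin
open import Data.Nat.Base
open import Data.Nat.Properties
open import Data.List.Base using (List; []; _∷_; [_]; _++_; _∷ʳ_; length; lookup; map; filter; allFin; tabulate; foldl; reverse)
open import Data.List.Membership.DecPropositional _≟_ using (_∈?_)
open import Data.List.Membership.Propositional using (_∈_; _∉_)
open import Data.List.Membership.Propositional.Properties
open import Data.List.Properties hiding (≡-dec)
open import Data.List.Relation.Binary.Permutation.Propositional using (module PermutationReasoning; _↭_; ↭-refl; ↭-reflexive; ↭-sym; ↭-trans; prep; ↭⇒↭ₛ)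
open import Data.List.Relation.Binary.Permutation.Propositional.Properties as Perm using (↭-length; ∈-resp-↭; shift; filter-↭)
open import Data.List.Relation.Binary.Permutation.Setoid.Properties using (Unique-resp-↭)
open import Data.List.Relation.Binary.Subset.Propositional using (_⊆_)
open import Data.List.Relation.Unary.All as All using (All; []; _∷_)
import Data.List.Relation.Unary.All.Properties as All
open import Data.List.Relation.Unary.AllPairs as AllPairs using (AllPairs; []; _∷_)
import Data.List.Relation.Unary.AllPairs.Properties as AllPairs
open import Data.List.Relation.Unary.Any as Any using (here; there)
open import Data.List.Relation.Unary.Any.Properties using (lookup-index)
open import Data.List.Relation.Unary.Unique.Propositional using (Unique)
import Data.List.Relation.Unary.Unique.Propositional.Properties as Unique
open import Data.Nat.Solver using (module +-*-Solver)
open import Data.Product.Base using (∃-syntax; _×_; _,_; proj₁; proj₂)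
open import Data.Sum.Base using (inj₁; inj₂)
open import Data.Vec.Base as Vec using (Vec; _∷_; [])
open import Data.Vec.Properties using (≡-dec)
open import Function.Base using (_∘_; id)
open import Function.Bundles using (Equivalence)
open import Relation.Binary.PropositionalEquality hiding ([_])
open import Relation.Binary.Definitions using (tri<; tri≈; tri>)
open import Relation.Nullary using (Dec; yes; no; does; ¬_; ¬?; contradiction; _×-dec_; _→-dec_)
open import Relation.Nullary.Decidable using (dec-true; dec-false)
open import Relation.Unary using (Decidable)
open import Data.Bool.Base using (true; false; if_then_else_)

open +-*-Solver using (solve; _:+_; _:=_)

private variable
  A B C : Set

-- Finite sets as duplicate-free lists

-- The elements of `xs` are cut out of `ys` one at a time; since `xs` has no repetition, each cut
-- leaves the later ones in place.
⊆⇒∃-complement : {xs ys : List A} → Unique xs → xs ⊆ ys → ∃[ zs ] ys ↭ xs ++ zs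
⊆⇒∃-complement {xs = []} _ _ = _ , ↭-refl
⊆⇒∃-complement {xs = x ∷ xs} {ys} (x∉xs ∷ xs!) xs⊆ys with ∈-∃++ (xs⊆ys (here refl))
... | ps , qs , refl =
  let zs , π = ⊆⇒∃-complement xs! xs⊆ps++qs in zs , ↭-trans (shift x ps qs) (prep x π)
  where
  xs⊆ps++qs : xs ⊆ ps ++ qs
  xs⊆ps++qs y∈xs with ∈-resp-↭ (shift x ps qs) (xs⊆ys (there y∈xs))
  ... | here refl = contradiction refl (All.lookup x∉xs y∈xs)
  ... | there y∈ = y∈

⊆⇒length≤ : {xs ys : List A} → Unique xs → xs ⊆ ys → length xs ≤ length ys
⊆⇒length≤ {xs = xs} xs! xs⊆ys with ⊆⇒∃-complement xs! xs⊆ys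
... | zs , π = subst (length xs ≤_) (sym (trans (↭-length π) (length-++ xs))) (m≤m+n _ _)

⊆∧length≤⇒↭ : {xs ys : List A} → Unique xs → xs ⊆ ys → length ys ≤ length xs → xs ↭ ys
⊆∧length≤⇒↭ {xs = xs} xs! xs⊆ys ys≤xs with ⊆⇒∃-complement xs! xs⊆ys
... | [] , π = ↭-sym (↭-trans π (↭-reflexive (++-identityʳ xs)))
... | z ∷ zs , π = contradiction
  (≤-trans (m<m+n (length xs) (s≤s z≤n)) (≤-reflexive (sym (trans (↭-length π) (length-++ xs)))))
  (≤⇒≯ ys≤xs)

-- Comparing `g` with `f` avoids injectivity of `g` itself: codes that carry proofs may differ and
-- still stand for the same word.
Unique-map⁻∘map⁺ : {f : A → B} {g : A → C} → (∀ {x y} → g x ≡ g y → f x ≡ f y) →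
                   ∀ {xs} → Unique (map f xs) → Unique (map g xs)
Unique-map⁻∘map⁺ inj u = AllPairs.map⁺ (AllPairs.map (λ fx≢fy gx≡gy → fx≢fy (inj gx≡gy)) (AllPairs.map⁻ u))

∃-preimage : (f : A → B) {ys : List B} → All (λ y → ∃[ x ] f x ≡ y) ys → ∃[ xs ] map f xs ≡ ys
∃-preimage f [] = [] , refl
∃-preimage f ((x , refl) ∷ ps) = let xs , eq = ∃-preimage f ps in x ∷ xs , cong (f x ∷_) eq

-- Counting

indicator : {P : Set} → Dec P → ℕ
indicator d = if does d then 1 else 0

indicator-cong : {P Q : Set} (p? : Dec P) (q? : Dec Q) → (P → Q) → (Q → P) → indicator p? ≡ indicator q?
indicator-cong (yes p) q? to _ = sym (cong (if_then 1 else 0) (dec-true q? (to p)))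
indicator-cong (no ¬p) q? _ from = sym (cong (if_then 1 else 0) (dec-false q? (¬p ∘ from)))

indicator-yes : {P : Set} (p? : Dec P) → P → indicator p? ≡ 1
indicator-yes p? p = cong (if_then 1 else 0) (dec-true p? p)

indicator-no : {P : Set} (p? : Dec P) → ¬ P → indicator p? ≡ 0
indicator-no p? ¬p = cong (if_then 1 else 0) (dec-false p? ¬p)

count-∷ : {P : A → Set} (P? : Decidable P) (x : A) (xs : List A) → count P? (x ∷ xs) ≡ indicator (P? x) + count P? xs
count-∷ P? x xs with does (P? x)
... | true = refl
... | false = refl

count-cong : {P Q : A → Set} (P? : Decidable P) (Q? : Decidable Q) → (∀ x → P x → Q x) → (∀ x → Q x → P x) →
             ∀ xs → count P? xs ≡ count Q? xs
count-cong P? Q? to from xs = cong length (filter-≐ P? Q? ((λ {x} → to x) , (λ {x} → from x)) xs)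

count-map : {P : B → Set} (P? : Decidable P) (f : A → B) (xs : List A) → count P? (map f xs) ≡ count (P? ∘ f) xs
count-map P? f [] = refl
count-map P? f (x ∷ xs) =
  trans (count-∷ P? (f x) (map f xs)) (trans (cong (indicator (P? (f x)) +_) (count-map P? f xs)) (sym (count-∷ (P? ∘ f) x xs)))

count-↭ : {P : A → Set} (P? : Decidable P) {xs ys : List A} → xs ↭ ys → count P? xs ≡ count P? ys
count-↭ P? π = ↭-length (filter-↭ P? π)

-- The common recursion behind `rlmax-∷`, `rlmin-∷`, `asc-∷` and `#LRMax≡lrmax`: in each case only
-- the first position remains to be evaluated.
#positions-∷ : ∀ x w {P : Fin (suc (length w)) → Set} {Q : Fin (length w) → Set} (P? : Decidable P) (Q? : Decidable Q) →
               (∀ i → P (suc i) → Q i) → (∀ i → Q i → P (suc i)) →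
               #positions (x ∷ w) P? ≡ indicator (P? zero) + #positions w Q?
#positions-∷ x w P? Q? to from = trans (count-∷ P? zero (tabulate suc)) (cong (indicator (P? zero) +_) (begin
  count P? (tabulate suc)                 ≡⟨ cong (count P?) (map-tabulate id suc) ⟨
  count P? (map suc (allFin (length w)))  ≡⟨ count-map P? suc (allFin (length w)) ⟩
  count (P? ∘ suc) (allFin (length w))    ≡⟨ count-cong (P? ∘ suc) Q? to from (allFin (length w)) ⟩
  #positions w Q?                         ∎))
  where open ≡-Reasoning

-- A bijection given by a set of codes: code c stands for u c on one side and
-- for v c on the other.  Surjectivity of v follows from finiteness.
equallyDistributed-via : ∀ {k} {X : List A} → Unique X → (fs gs : Vec (A → ℕ) k) (u v : C → A) →
  (∀ {x} → x ∈ X → ∃[ c ] u c ≡ x) → (∀ c → v c ∈ X) → (∀ {c c′} → v c ≡ v c′ → u c ≡ u c′) →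
  (∀ c → values fs (u c) ≡ values gs (v c)) → EquallyDistributed X fs gs
equallyDistributed-via {X = X} X! fs gs u v u-surjective v∈X v-injective eq a
  with ∃-preimage u (All.tabulate u-surjective)
... | cs , refl = begin
  count (at fs) (map u cs)  ≡⟨ count-map (at fs) u cs ⟩
  count (at fs ∘ u) cs      ≡⟨ count-cong (at fs ∘ u) (at gs ∘ v) (λ c → trans (sym (eq c))) (λ c → trans (eq c)) cs ⟩
  count (at gs ∘ v) cs      ≡⟨ count-map (at gs) v cs ⟨
  count (at gs) (map v cs)  ≡⟨ count-↭ (at gs) vcs↭ucs ⟩
  count (at gs) (map u cs)  ∎
  where
  open ≡-Reasoning
  at : (hs : Vec _ _) → Decidable (λ x → values hs x ≡ a)
  at hs x = ≡-dec _≟_ (values hs x) a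
  vcs⊆ucs : map v cs ⊆ map u cs
  vcs⊆ucs x∈ with ∈-map⁻ v x∈
  ... | c , _ , refl = v∈X c
  vcs↭ucs : map v cs ↭ map u cs
  vcs↭ucs = ⊆∧length≤⇒↭ (Unique-map⁻∘map⁺ v-injective X!) vcs⊆ucs
    (≤-reflexive (trans (length-map u cs) (sym (length-map v cs))))

-- Permutations of [n]

[1⋯]-unique : ∀ n → Unique [1⋯ n ]
[1⋯]-unique n = Unique.map⁺ suc-injective (Unique.upTo⁺ n)

∈-[1⋯]⁺ : ∀ {n x} → 1 ≤ x → x ≤ n → x ∈ [1⋯ n ]
∈-[1⋯]⁺ {x = suc x} _ x<n = ∈-map⁺ suc (∈-upTo⁺ x<n)

∈-[1⋯]⁻ : ∀ {n x} → x ∈ [1⋯ n ] → 1 ≤ x × x ≤ n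
∈-[1⋯]⁻ x∈ with ∈-map⁻ suc x∈
... | y , y∈ , refl = s≤s z≤n , ∈-upTo⁻ y∈

perm⇒Unique : ∀ {n w} → IsPermutation n w → Unique w
perm⇒Unique {n} π = Unique-resp-↭ (setoid ℕ) (↭⇒↭ₛ (↭-sym π)) ([1⋯]-unique n)

perm⇒bounds : ∀ {n w} → IsPermutation n w → All (λ x → 1 ≤ x × x ≤ n) w
perm⇒bounds π = All.tabulate (∈-[1⋯]⁻ ∘ ∈-resp-↭ π)

perm⇒∈ : ∀ {n w x} → IsPermutation n w → 1 ≤ x → x ≤ n → x ∈ w
perm⇒∈ π 1≤x x≤n = ∈-resp-↭ (↭-sym π) (∈-[1⋯]⁺ 1≤x x≤n)

perm⇒length : ∀ {n w} → IsPermutation n w → length w ≡ n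
perm⇒length {n} π = trans (↭-length π) (length-[1⋯] n)

perm⁺ : ∀ {n w} → Unique w → All (λ x → 1 ≤ x × x ≤ n) w → length w ≡ n → IsPermutation n w
perm⁺ {n} w! bounds len = ⊆∧length≤⇒↭ w! (λ x∈ → let 1≤x , x≤n = All.lookup bounds x∈ in ∈-[1⋯]⁺ 1≤x x≤n)
  (≤-reflexive (trans (length-[1⋯] n) (sym len)))

-- Recursive forms of the statistics

All-lookup⁺ : {P : ℕ → Set} (w : Word) → (∀ j → P (lookup w j)) → All P w
All-lookup⁺ {P} w h = All.tabulate (λ x∈w → subst P (sym (lookup-index x∈w)) (h (Any.index x∈w)))

rlmax-∷ : ∀ x w → rlmax (x ∷ w) ≡ indicator (All.all? (_<? x) w) + rlmax w
rlmax-∷ x w = trans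
  (#positions-∷ x w (isRLMax? (x ∷ w)) (isRLMax? w)
    (λ i h j i<j → h (suc j) (s≤s i<j)) (λ { i h (suc j) (s≤s i<j) → h j i<j }))
  (cong (_+ rlmax w) (indicator-cong (isRLMax? (x ∷ w) zero) (All.all? (_<? x) w)
    (λ h → All-lookup⁺ w (λ j → h (suc j) (s≤s z≤n))) (λ { h (suc j) _ → All.lookup h (∈-lookup j) })))

rlmin-∷ : ∀ x w → rlmin (x ∷ w) ≡ indicator (All.all? (x <?_) w) + rlmin w
rlmin-∷ x w = trans
  (#positions-∷ x w (isRLMin? (x ∷ w)) (isRLMin? w)
    (λ i h j i<j → h (suc j) (s≤s i<j)) (λ { i h (suc j) (s≤s i<j) → h j i<j }))
  (cong (_+ rlmin w) (indicator-cong (isRLMin? (x ∷ w) zero) (All.all? (x <?_) w)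
    (λ h → All-lookup⁺ w (λ j → h (suc j) (s≤s z≤n))) (λ { h (suc j) _ → All.lookup h (∈-lookup j) })))

firstAscent : ℕ → Word → ℕ
firstAscent x []      = 0
firstAscent x (y ∷ _) = indicator (x <? y)

asc-∷ : ∀ x w → asc (x ∷ w) ≡ firstAscent x w + asc w
asc-∷ x w = trans
  (#positions-∷ x w (isAscent? (x ∷ w)) (isAscent? w)
    (λ { i (suc j , eq , lt) → j , suc-injective eq , lt }) (λ { i (j , eq , lt) → suc j , cong suc eq , lt }))
  (cong (_+ asc w) (first x w))
  where
  first : ∀ x w → indicator (isAscent? (x ∷ w) zero) ≡ firstAscent x w
  first x [] = refl
  first x (y ∷ w) = indicator-cong (isAscent? (x ∷ y ∷ w) zero) (x <? y)
    (λ { (suc zero , _ , lt) → lt }) (λ lt → suc zero , refl , lt)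

-- Left-to-right maxima and non-mid-point weak excedances.

lrmax : ℕ → Word → ℕ
lrmax b []      = 0
lrmax b (x ∷ w) = indicator (b <? x) + lrmax (b ⊔ x) w

IsLRMax : ℕ → (w : Word) → Fin (length w) → Set
IsLRMax b w i = b < lookup w i × (∀ j → j Fin.< i → lookup w j < lookup w i)

isLRMax? : ∀ b w → Decidable (IsLRMax b w)
isLRMax? b w i = (b <? lookup w i) ×-dec Fin.all? λ j → (j Fin.<? i) →-dec (lookup w j <? lookup w i)

-- The bound `b` acts like a letter placed before the word, so passing `x` raises it to `b ⊔ x`. The
-- positional count is the one that can be compared with `wnm` index by index.
#LRMax≡lrmax : ∀ b w → #positions w (isLRMax? b w) ≡ lrmax b w
#LRMax≡lrmax b [] = refl
#LRMax≡lrmax b (x ∷ w) = trans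
  (#positions-∷ x w (isLRMax? b (x ∷ w)) (isLRMax? (b ⊔ x) w)
    (λ { i (b< , h) → ⊔-pres-<m b< (h zero (s≤s z≤n)) , λ j j<i → h (suc j) (s≤s j<i) })
    (λ { i (b⊔x< , h) → m⊔n<o⇒m<o b x b⊔x< , λ { zero _ → m⊔n<o⇒n<o b x b⊔x< ; (suc j) (s≤s j<i) → h j j<i } }))
  (cong₂ _+_ (indicator-cong (isLRMax? b (x ∷ w) zero) (b <? x) proj₁ (λ b<x → b<x , λ _ ())) (#LRMax≡lrmax (b ⊔ x) w))

-- Mid-points are defined by positions, while the counting arguments below concern the letters on
-- either side; this record translates between the two.
record Split (w : Word) (i : Fin (length w)) : Set where
  field
    before after : Word
    whole        : w ≡ before ++ lookup w i ∷ after
    length-before : length before ≡ toℕ i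
    before⁺ : ∀ j → j Fin.< i → lookup w j ∈ before
    before⁻ : ∀ {y} → y ∈ before → ∃[ j ] j Fin.< i × lookup w j ≡ y
    after⁻  : ∀ {z} → z ∈ after → ∃[ k ] i Fin.< k × lookup w k ≡ z

split : ∀ w i → Split w i
split (x ∷ w) zero = record
  { before = [] ; after = w ; whole = refl ; length-before = refl
  ; before⁺ = λ _ () ; before⁻ = λ ()
  ; after⁻ = λ z∈w → suc (Any.index z∈w) , s≤s z≤n , sym (lookup-index z∈w)
  }
split (x ∷ w) (suc i) = record
  { before = x ∷ before ; after = after ; whole = cong (x ∷_) whole ; length-before = cong suc length-before
  ; before⁺ = λ { zero _ → here refl ; (suc j) (s≤s j<i) → there (before⁺ j j<i) }
  ; before⁻ = λ { (here refl) → zero , s≤s z≤n , refl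
                ; (there y∈) → let j , j<i , eq = before⁻ y∈ in suc j , s≤s j<i , eq }
  ; after⁻ = λ z∈ → let k , i<k , eq = after⁻ z∈ in suc k , s≤s i<k , eq }
  where open Split (split w i)

Unique-++⁻ˡ : ∀ (ps : Word) {qs} → Unique (ps ++ qs) → Unique ps
Unique-++⁻ˡ [] _ = []
Unique-++⁻ˡ (p ∷ ps) (p∉ ∷ u) = All.++⁻ˡ ps p∉ ∷ Unique-++⁻ˡ ps u

Unique-++⁻ʳ : ∀ (ps : Word) {qs} → Unique (ps ++ qs) → Unique qs
Unique-++⁻ʳ [] u = u
Unique-++⁻ʳ (p ∷ ps) (_ ∷ u) = Unique-++⁻ʳ ps u

Unique-++⇒∉ : ∀ (ps : Word) {qs y} → Unique (ps ++ qs) → y ∈ ps → y ∉ qs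
Unique-++⇒∉ (p ∷ ps) (p∉ ∷ _) (here refl) y∈qs = All.lookup p∉ (∈-++⁺ʳ ps y∈qs) refl
Unique-++⇒∉ (p ∷ ps) (_ ∷ u) (there y∈ps) = Unique-++⇒∉ ps u y∈ps

Unique-++-∷⇒∉ : {x : ℕ} (ps : Word) {qs : Word} → Unique (ps ++ x ∷ qs) → x ∉ ps × x ∉ qs
Unique-++-∷⇒∉ {x} ps {qs} u with Unique-resp-↭ (setoid ℕ) (↭⇒↭ₛ (shift x ps qs)) u
... | x∉ ∷ _ = (λ x∈ → All.lookup x∉ (∈-++⁺ˡ x∈) refl) , (λ x∈ → All.lookup x∉ (∈-++⁺ʳ ps x∈) refl)

-- A letter x that exceeds everything before it leaves room for at most x ∸ 1
-- letters there.
lrmax⇒weakExcedance : ∀ {n} ps {x qs} → IsPermutation n (ps ++ x ∷ qs) → All (_< x) ps → suc (length ps) ≤ x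
lrmax⇒weakExcedance {n} ps {x} {qs} π ps<x = subst (suc (length ps) ≤_) (length-[1⋯] x) (⊆⇒length≤ x∷ps! x∷ps⊆)
  where
  x∷ps! : Unique (x ∷ ps)
  x∷ps! = Unique-++⁻ˡ (x ∷ ps) (Unique-resp-↭ (setoid ℕ) (↭⇒↭ₛ (shift x ps qs)) (perm⇒Unique π))
  positive : ∀ {y} → y ∈ ps ++ x ∷ qs → 1 ≤ y
  positive y∈ = proj₁ (All.lookup (perm⇒bounds π) y∈)
  x∷ps⊆ : x ∷ ps ⊆ [1⋯ x ]
  x∷ps⊆ (here refl) = ∈-[1⋯]⁺ (positive (∈-++⁺ʳ ps (here refl))) ≤-refl
  x∷ps⊆ (there y∈) = ∈-[1⋯]⁺ (positive (∈-++⁺ˡ y∈)) (<⇒≤ (All.lookup ps<x y∈))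

-- If y > x occurs before x and nothing smaller than x occurs after it, the x
-- letters of [x] are x itself and letters before x other than y.
weakExcedance∧nonMid⇒lrmax : ∀ {n} ps {x qs} → IsPermutation n (ps ++ x ∷ qs) → suc (length ps) ≤ x →
  (∀ {y z} → y ∈ ps → z ∈ qs → x < y → ¬ z < x) → All (_< x) ps
weakExcedance∧nonMid⇒lrmax {n} ps {x} {qs} π |ps|<x nonMid = All.tabulate ps<x
  where
  ps<x : ∀ {y} → y ∈ ps → y < x
  ps<x {y} y∈ with y <? x
  ... | yes y<x = y<x
  ... | no y≮x with ∈-∃++ y∈
  ... | ps₁ , ps₂ , refl = contradiction |ps|<x (≤⇒≯ x≤|ps|)
    where
    x<y : x < y
    x<y = ≤∧≢⇒< (≮⇒≥ y≮x) (λ { refl → proj₁ (Unique-++-∷⇒∉ ps (perm⇒Unique π)) y∈ })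
    [x]⊆ : [1⋯ x ] ⊆ x ∷ ps₁ ++ ps₂
    [x]⊆ {z} z∈ with ∈-[1⋯]⁻ z∈
    ... | 1≤z , z≤x with ∈-++⁻ ps (perm⇒∈ π 1≤z (≤-trans z≤x (proj₂ (All.lookup (perm⇒bounds π) (∈-++⁺ʳ ps (here refl))))))
    ... | inj₂ (here z≡x) = here z≡x
    ... | inj₂ (there z∈qs) with m≤n⇒m<n∨m≡n z≤x
    ...   | inj₁ z<x = contradiction z<x (nonMid y∈ z∈qs x<y)
    ...   | inj₂ z≡x = here z≡x
    [x]⊆ {z} z∈ | 1≤z , z≤x | inj₁ z∈ps with ∈-resp-↭ (shift y ps₁ ps₂) z∈ps
    ...   | here refl = contradiction x<y (≤⇒≯ z≤x)
    ...   | there z∈′ = there z∈′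
    x≤|ps| : x ≤ length ps
    x≤|ps| = subst₂ _≤_ (length-[1⋯] x) (sym (↭-length (shift y ps₁ ps₂))) (⊆⇒length≤ ([1⋯]-unique x) [x]⊆)

wnm≡lrmax : ∀ {n} w → IsPermutation n w → wnm w ≡ lrmax 0 w
wnm≡lrmax {n} w π = trans (count-cong _ (isLRMax? 0 w) to from (allFin (length w))) (#LRMax≡lrmax 0 w)
  where
  to : ∀ i → IsWeakExcedance w i × ¬ IsMidPoint w i → IsLRMax 0 w i
  to i (we , nonMid) = ≤-trans (s≤s z≤n) we , λ j j<i → All.lookup before<x (before⁺ j j<i)
    where
    open Split (split w i)
    before<x : All (_< lookup w i) before
    before<x = weakExcedance∧nonMid⇒lrmax before (subst (IsPermutation n) whole π)
      (subst (λ l → suc l ≤ lookup w i) (sym length-before) we)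
      λ y∈ z∈ x<y z<x → let j , j<i , eqʸ = before⁻ y∈ ; k , i<k , eqᶻ = after⁻ z∈ in
        nonMid (j , k , j<i , i<k , subst (lookup w i <_) (sym eqʸ) x<y , subst (_< lookup w i) (sym eqᶻ) z<x)
  from : ∀ i → IsLRMax 0 w i → IsWeakExcedance w i × ¬ IsMidPoint w i
  from i (_ , max) = subst (λ l → suc l ≤ lookup w i) length-before
      (lrmax⇒weakExcedance before (subst (IsPermutation n) whole π) (All.tabulate before<x))
    , λ { (j , k , j<i , _ , wi<wj , _) → <-asym wi<wj (max j j<i) }
    where
    open Split (split w i)
    before<x : ∀ {y} → y ∈ before → y < lookup w i
    before<x y∈ with before⁻ y∈
    ... | j , j<i , refl = max j j<i

-- Effect of extreme letters and of concatenation on the statistics.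

rlmax-∷-max : ∀ {m w} → All (_< m) w → rlmax (m ∷ w) ≡ suc (rlmax w)
rlmax-∷-max {m} {w} w<m = trans (rlmax-∷ m w) (cong (_+ rlmax w) (indicator-yes (All.all? (_<? m) w) w<m))

-- Each letter of `a` has the larger `m` to its right.
rlmax-++-∷ : ∀ a {m w} → All (_< m) a → rlmax (a ++ m ∷ w) ≡ rlmax (m ∷ w)
rlmax-++-∷ [] [] = refl
rlmax-++-∷ (x ∷ a) {m} {w} (x<m ∷ a<m) = trans (rlmax-∷ x (a ++ m ∷ w)) (cong₂ _+_
  (indicator-no (All.all? (_<? x) (a ++ m ∷ w)) (λ <x → <-asym x<m (All.lookup <x (∈-++⁺ʳ a (here refl)))))
  (rlmax-++-∷ a a<m))

rlmax-++-max : ∀ a {m w} → All (_< m) a → All (_< m) w → rlmax (a ++ m ∷ w) ≡ suc (rlmax w)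
rlmax-++-max a a<m w<m = trans (rlmax-++-∷ a a<m) (rlmax-∷-max w<m)

rlmin-++-∷ : ∀ a {m w} → All (m <_) a → rlmin (a ++ m ∷ w) ≡ rlmin (m ∷ w)
rlmin-++-∷ [] [] = refl
rlmin-++-∷ (x ∷ a) {m} {w} (m<x ∷ m<a) = trans (rlmin-∷ x (a ++ m ∷ w)) (cong₂ _+_
  (indicator-no (All.all? (x <?_) (a ++ m ∷ w)) (λ x< → <-asym m<x (All.lookup x< (∈-++⁺ʳ a (here refl)))))
  (rlmin-++-∷ a m<a))

rlmin-++-min : ∀ a {m w} → All (m <_) a → All (m <_) w → rlmin (a ++ m ∷ w) ≡ suc (rlmin w)
rlmin-++-min a {m} {w} m<a m<w = trans (rlmin-++-∷ a m<a)
  (trans (rlmin-∷ m w) (cong (_+ rlmin w) (indicator-yes (All.all? (m <?_) w) m<w)))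

-- The shared letter `m` belongs to both factors, so every adjacent pair is counted exactly once.
asc-++-∷ : ∀ a m b → asc (a ++ m ∷ b) ≡ asc (a ++ [ m ]) + asc (m ∷ b)
asc-++-∷ [] m b = refl
asc-++-∷ (x ∷ a) m b = begin
  asc (x ∷ a ++ m ∷ b)                                          ≡⟨ asc-∷ x (a ++ m ∷ b) ⟩
  firstAscent x (a ++ m ∷ b) + asc (a ++ m ∷ b)                 ≡⟨ cong₂ _+_ (first a) (asc-++-∷ a m b) ⟩
  firstAscent x (a ++ [ m ]) + (asc (a ++ [ m ]) + asc (m ∷ b)) ≡⟨ +-assoc (firstAscent x (a ++ [ m ])) _ _ ⟨
  firstAscent x (a ++ [ m ]) + asc (a ++ [ m ]) + asc (m ∷ b)   ≡⟨ cong (_+ asc (m ∷ b)) (asc-∷ x (a ++ [ m ])) ⟨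
  asc (x ∷ a ++ [ m ]) + asc (m ∷ b)                            ∎
  where
  open ≡-Reasoning
  first : ∀ a → firstAscent x (a ++ m ∷ b) ≡ firstAscent x (a ++ [ m ])
  first [] = refl
  first (_ ∷ _) = refl

asc-∷-max : ∀ {m w} → All (_< m) w → asc (m ∷ w) ≡ asc w
asc-∷-max {m} {[]} _ = refl
asc-∷-max {m} {y ∷ w} (y<m ∷ _) = trans (asc-∷ m (y ∷ w)) (cong (_+ asc (y ∷ w)) (indicator-no (m <? y) (<-asym y<m)))

asc-∷-min : ∀ {m y w} → m < y → asc (m ∷ y ∷ w) ≡ suc (asc (y ∷ w))
asc-∷-min {m} {y} {w} m<y = trans (asc-∷ m (y ∷ w)) (cong (_+ asc (y ∷ w)) (indicator-yes (m <? y) m<y))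

asc-∷ʳ-max : ∀ x w {m} → All (_< m) (x ∷ w) → asc (x ∷ w ++ [ m ]) ≡ suc (asc (x ∷ w))
asc-∷ʳ-max x [] (x<m ∷ []) = asc-∷-min x<m
asc-∷ʳ-max x (y ∷ w) {m} (_ ∷ <m) = begin
  asc (x ∷ y ∷ w ++ [ m ])                          ≡⟨ asc-∷ x (y ∷ w ++ [ m ]) ⟩
  indicator (x <? y) + asc (y ∷ w ++ [ m ])         ≡⟨ cong (indicator (x <? y) +_) (asc-∷ʳ-max y w <m) ⟩
  indicator (x <? y) + suc (asc (y ∷ w))            ≡⟨ +-suc (indicator (x <? y)) (asc (y ∷ w)) ⟩
  suc (indicator (x <? y) + asc (y ∷ w))            ≡⟨ cong suc (asc-∷ x (y ∷ w)) ⟨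
  suc (asc (x ∷ y ∷ w))                             ∎
  where open ≡-Reasoning

-- Either side adds one ascent to a nonempty word and none to the empty one. In `asc-join` this
-- gives `A` and `B` the same form.
asc-∷-min≡asc-∷ʳ-max : ∀ {l m w} → All (l <_) w → All (_< m) w → asc (l ∷ w) ≡ asc (w ++ [ m ])
asc-∷-min≡asc-∷ʳ-max {w = []} _ _ = refl
asc-∷-min≡asc-∷ʳ-max {w = x ∷ w} (l<x ∷ _) w<m = trans (asc-∷-min l<x) (sym (asc-∷ʳ-max x w w<m))

maximum : ℕ → Word → ℕ
maximum = foldl _⊔_

maximum-< : ∀ {b m} w → b < m → All (_< m) w → maximum b w < m
maximum-< [] b<m [] = b<m
maximum-< (x ∷ w) b<m (x<m ∷ w<m) = maximum-< w (⊔-pres-<m b<m x<m) w<m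

maximum-<⁻ : ∀ {b m} w → maximum b w < m → b < m × All (_< m) w
maximum-<⁻ [] b<m = b<m , []
maximum-<⁻ {b} (x ∷ w) h = let b⊔x<m , w<m = maximum-<⁻ w h in m⊔n<o⇒m<o b x b⊔x<m , m⊔n<o⇒n<o b x b⊔x<m ∷ w<m

lrmax-++ : ∀ b p q → lrmax b (p ++ q) ≡ lrmax b p + lrmax (maximum b p) q
lrmax-++ b [] q = refl
lrmax-++ b (x ∷ p) q = trans (cong (indicator (b <? x) +_) (lrmax-++ (b ⊔ x) p q))
  (sym (+-assoc (indicator (b <? x)) (lrmax (b ⊔ x) p) _))

lrmax-∷-> : ∀ {b x} w → b < x → lrmax b (x ∷ w) ≡ suc (lrmax x w)
lrmax-∷-> {b} {x} w b<x = cong₂ _+_ (indicator-yes (b <? x) b<x) (cong (λ c → lrmax c w) (m≤n⇒m⊔n≡n (<⇒≤ b<x)))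

lrmax-below : ∀ {b} p q → All (_< b) p → lrmax b (p ++ q) ≡ lrmax b q
lrmax-below [] q [] = refl
lrmax-below {b} (x ∷ p) q (x<b ∷ p<b) = trans
  (cong₂ _+_ (indicator-no (b <? x) (<-asym x<b)) (cong (λ c → lrmax c (p ++ q)) (m≥n⇒m⊔n≡m (<⇒≤ x<b))))
  (lrmax-below p q p<b)

lrmax-++-max : ∀ {b m} p q → b < m → All (_< m) p → lrmax b (p ++ m ∷ q) ≡ lrmax b p + suc (lrmax m q)
lrmax-++-max {b} {m} p q b<m p<m = trans (lrmax-++ b p (m ∷ q)) (cong (lrmax b p +_) (lrmax-∷-> q (maximum-< p b<m p<m)))

-- Strictly increasing relabellings

StrictlyIncreasing : (ℕ → ℕ) → Set
StrictlyIncreasing f = ∀ {x y} → x < y → f x < f y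

module _ {f : ℕ → ℕ} (f-mono : StrictlyIncreasing f) where

  mono-≤ : ∀ {x y} → x ≤ y → f x ≤ f y
  mono-≤ x≤y with m≤n⇒m<n∨m≡n x≤y
  ... | inj₁ x<y = <⇒≤ (f-mono x<y)
  ... | inj₂ refl = ≤-refl

  mono-reflects-< : ∀ {x y} → f x < f y → x < y
  mono-reflects-< {x} {y} fx<fy with x <? y
  ... | yes x<y = x<y
  ... | no x≮y = contradiction (mono-≤ (≮⇒≥ x≮y)) (<⇒≱ fx<fy)

  mono-injective : ∀ {x y} → f x ≡ f y → x ≡ y
  mono-injective {x} {y} eq with <-cmp x y
  ... | tri< x<y _ _ = contradiction eq (<⇒≢ (f-mono x<y))
  ... | tri≈ _ x≡y _ = x≡y
  ... | tri> _ _ y<x = contradiction (sym eq) (<⇒≢ (f-mono y<x))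

  indicator-<-map : ∀ x y → indicator (f x <? f y) ≡ indicator (x <? y)
  indicator-<-map x y = indicator-cong (f x <? f y) (x <? y) mono-reflects-< f-mono

  rlmax-map : ∀ w → rlmax (map f w) ≡ rlmax w
  rlmax-map [] = refl
  rlmax-map (x ∷ w) = trans (rlmax-∷ (f x) (map f w)) (trans (cong₂ _+_
    (indicator-cong (All.all? (_<? f x) (map f w)) (All.all? (_<? x) w)
      (λ h → All.map mono-reflects-< (All.map⁻ h)) (λ h → All.map⁺ (All.map f-mono h)))
    (rlmax-map w)) (sym (rlmax-∷ x w)))

  rlmin-map : ∀ w → rlmin (map f w) ≡ rlmin w
  rlmin-map [] = refl
  rlmin-map (x ∷ w) = trans (rlmin-∷ (f x) (map f w)) (trans (cong₂ _+_
    (indicator-cong (All.all? (f x <?_) (map f w)) (All.all? (x <?_) w)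
      (λ h → All.map mono-reflects-< (All.map⁻ h)) (λ h → All.map⁺ (All.map f-mono h)))
    (rlmin-map w)) (sym (rlmin-∷ x w)))

  asc-map : ∀ w → asc (map f w) ≡ asc w
  asc-map [] = refl
  asc-map (x ∷ w) = trans (asc-∷ (f x) (map f w)) (trans (cong₂ _+_ (first w) (asc-map w)) (sym (asc-∷ x w)))
    where
    first : ∀ w → firstAscent (f x) (map f w) ≡ firstAscent x w
    first [] = refl
    first (y ∷ w) = indicator-<-map x y

  lrmax-map : ∀ b w → lrmax (f b) (map f w) ≡ lrmax b w
  lrmax-map b [] = refl
  lrmax-map b (x ∷ w) = cong₂ _+_ (indicator-<-map b x)
    (trans (cong (λ c → lrmax c (map f w)) (sym (mono-≤-distrib-⊔ mono-≤ b x))) (lrmax-map (b ⊔ x) w))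

-- The letters to the right of the letter 1

rightOf1 : Word → Word
rightOf1 []                = []
rightOf1 (zero ∷ w)        = rightOf1 w
rightOf1 (suc zero ∷ w)    = w
rightOf1 (suc (suc x) ∷ w) = rightOf1 w

leftOf1-++ʳ : ∀ a b → All (1 <_) a → leftOf1 (a ++ b) ≡ a ++ leftOf1 b
leftOf1-++ʳ [] b [] = refl
leftOf1-++ʳ (suc zero ∷ a) b (s≤s () ∷ _)
leftOf1-++ʳ (suc (suc x) ∷ a) b (_ ∷ 1<a) = cong (suc (suc x) ∷_) (leftOf1-++ʳ a b 1<a)

leftOf1-++ˡ : ∀ a b → 1 ∈ a → leftOf1 (a ++ b) ≡ leftOf1 a
leftOf1-++ˡ (zero ∷ a) b (there 1∈a) = cong (zero ∷_) (leftOf1-++ˡ a b 1∈a)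
leftOf1-++ˡ (suc zero ∷ a) b _ = refl
leftOf1-++ˡ (suc (suc x) ∷ a) b (there 1∈a) = cong (suc (suc x) ∷_) (leftOf1-++ˡ a b 1∈a)

rightOf1-++ʳ : ∀ a b → All (1 <_) a → rightOf1 (a ++ b) ≡ rightOf1 b
rightOf1-++ʳ [] b [] = refl
rightOf1-++ʳ (suc zero ∷ a) b (s≤s () ∷ _)
rightOf1-++ʳ (suc (suc x) ∷ a) b (_ ∷ 1<a) = rightOf1-++ʳ a b 1<a

rightOf1-++ˡ : ∀ a b → 1 ∈ a → rightOf1 (a ++ b) ≡ rightOf1 a ++ b
rightOf1-++ˡ (zero ∷ a) b (there 1∈a) = rightOf1-++ˡ a b 1∈a
rightOf1-++ˡ (suc zero ∷ a) b _ = refl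
rightOf1-++ˡ (suc (suc x) ∷ a) b (there 1∈a) = rightOf1-++ˡ a b 1∈a

rightOf1-All : {P : ℕ → Set} → ∀ w → All P w → All P (rightOf1 w)
rightOf1-All [] [] = []
rightOf1-All (zero ∷ w) (_ ∷ ps) = rightOf1-All w ps
rightOf1-All (suc zero ∷ w) (_ ∷ ps) = ps
rightOf1-All (suc (suc x) ∷ w) (_ ∷ ps) = rightOf1-All w ps

leftOf1-split : ∀ L R → All (1 <_) L → leftOf1 (L ++ 1 ∷ R) ≡ L
leftOf1-split L R 1<L = trans (leftOf1-++ʳ L (1 ∷ R) 1<L) (++-identityʳ L)

rightOf1-split : ∀ L R → All (1 <_) L → rightOf1 (L ++ 1 ∷ R) ≡ R
rightOf1-split L R 1<L = rightOf1-++ʳ L (1 ∷ R) 1<L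

-- The middle statistic of all comparisons; the added one counts the letter 1 itself, the first
-- left-to-right maximum of `1 R`.
lrmaxRight : Word → ℕ
lrmaxRight u = suc (lrmax 0 (rightOf1 u))

-- Inserting a letter and renumbering

-- The increasing enumeration of the naturals other than `v`, the analogue of `punchIn` on `Fin`.
bump : ℕ → ℕ → ℕ
bump zero    x       = suc x
bump (suc v) zero    = zero
bump (suc v) (suc x) = suc (bump v x)

bump-mono : ∀ v → StrictlyIncreasing (bump v)
bump-mono zero x<y = s≤s x<y
bump-mono (suc v) {zero} {suc y} _ = s≤s z≤n
bump-mono (suc v) {suc x} {suc y} (s≤s x<y) = s≤s (bump-mono v x<y)

bump-injective : ∀ v {x y} → bump v x ≡ bump v y → x ≡ y
bump-injective v = mono-injective (bump-mono v)

bump-≢ : ∀ v x → v ≢ bump v x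
bump-≢ (suc v) (suc x) eq = bump-≢ v x (suc-injective eq)

bump-surjective : ∀ v x → v ≢ x → ∃[ y ] bump v y ≡ x
bump-surjective zero zero v≢x = contradiction refl v≢x
bump-surjective zero (suc x) _ = x , refl
bump-surjective (suc v) zero _ = 0 , refl
bump-surjective (suc v) (suc x) v≢x = let y , eq = bump-surjective v x (v≢x ∘ cong suc) in suc y , cong suc eq

bump-≥ : ∀ {v x} → v ≤ x → bump v x ≡ suc x
bump-≥ z≤n = refl
bump-≥ (s≤s v≤x) = cong suc (bump-≥ v≤x)

bump-< : ∀ {v x} → x < v → bump v x ≡ x
bump-< {suc v} {zero} _ = refl
bump-< {suc v} {suc x} (s≤s x<v) = cong suc (bump-< x<v)

x≤bump : ∀ v x → x ≤ bump v x
x≤bump zero x = n≤1+n x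
x≤bump (suc v) zero = z≤n
x≤bump (suc v) (suc x) = s≤s (x≤bump v x)

bump≤1+x : ∀ v x → bump v x ≤ suc x
bump≤1+x zero x = ≤-refl
bump≤1+x (suc v) zero = z≤n
bump≤1+x (suc v) (suc x) = s≤s (bump≤1+x v x)

bump->⇒≥ : ∀ {v x} → v < bump v x → v ≤ x
bump->⇒≥ {v} {x} v<bx with v ≤? x
... | yes v≤x = v≤x
... | no v≰x = contradiction (subst (v <_) (bump-< (≰⇒> v≰x)) v<bx) (<-asym (≰⇒> v≰x))

map-bump-< : ∀ {v w} → All (_< v) w → map (bump v) w ≡ w
map-bump-< [] = refl
map-bump-< (x<v ∷ w<v) = cong₂ _∷_ (bump-< x<v) (map-bump-< w<v)

prepend : ℕ → Word → Word
prepend v w = v ∷ map (bump v) w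

prepend-perm : ∀ {n v w} → 1 ≤ v → v ≤ suc n → IsPermutation n w → IsPermutation (suc n) (prepend v w)
prepend-perm {n} {v} {w} 1≤v v≤1+n π = perm⁺
  (All.map⁺ (All.tabulate (λ {x} _ → bump-≢ v x)) ∷ Unique.map⁺ (bump-injective v) (perm⇒Unique π))
  ((1≤v , v≤1+n) ∷ All.map⁺ (All.map (λ { {x} (1≤x , x≤n) → ≤-trans 1≤x (x≤bump v x) , ≤-trans (bump≤1+x v x) (s≤s x≤n) }) (perm⇒bounds π)))
  (cong suc (trans (length-map (bump v) w) (perm⇒length π)))

prepend-perm⁻ : ∀ {n v w} → IsPermutation (suc n) (v ∷ w) → ∃[ w′ ] w ≡ map (bump v) w′ × IsPermutation n w′
prepend-perm⁻ {n} {v} {w} π with perm⇒Unique π | perm⇒bounds π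
... | v∉w ∷ w! | (1≤v , v≤1+n) ∷ bounds
  with ∃-preimage (bump v) (All.map (λ {x} → bump-surjective v x) v∉w)
... | w′ , refl = w′ , refl , perm⁺ (Unique.map⁻ w!) (All.map lower (All.map⁻ bounds))
    (trans (sym (length-map (bump v) w′)) (suc-injective (perm⇒length π)))
  where
  lower : ∀ {x} → 1 ≤ bump v x × bump v x ≤ suc n → 1 ≤ x × x ≤ n
  lower {x} (1≤bx , bx≤1+n) = 1≤x x 1≤bx , x≤n
    where
    1≤x : ∀ x → 1 ≤ bump v x → 1 ≤ x
    1≤x zero 1≤b0 = contradiction (bump-< 1≤v) (λ eq → <⇒≢ 1≤b0 (sym eq))
    1≤x (suc x) _ = s≤s z≤n
    x≤n : x ≤ n
    x≤n with x ≤? n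
    ... | yes x≤n = x≤n
    -- Such an `x` is at least `v`, so `bump v` raises it above `suc n`.
    ... | no x≰n = contradiction (subst (_≤ suc n) (bump-≥ (≤-trans v≤1+n (≰⇒> x≰n))) bx≤1+n)
                     (λ 1+x≤1+n → x≰n (s≤s⁻¹ 1+x≤1+n))

rlmax-prepend-max : ∀ {v w} → All (_< v) w → rlmax (prepend v w) ≡ suc (rlmax w)
rlmax-prepend-max {v} {w} w<v = trans (cong (λ u → rlmax (v ∷ u)) (map-bump-< w<v)) (rlmax-∷-max w<v)

rlmax-prepend-≤ : ∀ {v w x} → x ∈ w → v ≤ x → rlmax (prepend v w) ≡ rlmax w
rlmax-prepend-≤ {v} {w} {x} x∈w v≤x = trans (rlmax-∷ v (map (bump v) w)) (cong₂ _+_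
  (indicator-no (All.all? (_<? v) (map (bump v) w))
    (λ <v → <⇒≱ (All.lookup <v (∈-map⁺ (bump v) x∈w)) (≤-trans v≤x (x≤bump v x))))
  (rlmax-map (bump-mono v) w))

rlmin-prepend-min : ∀ {v w} → All (v ≤_) w → rlmin (prepend v w) ≡ suc (rlmin w)
rlmin-prepend-min {v} {w} v≤w = trans (rlmin-∷ v (map (bump v) w)) (cong₂ _+_
  (indicator-yes (All.all? (v <?_) (map (bump v) w))
    (All.map⁺ (All.map (λ v≤x → subst (v <_) (sym (bump-≥ v≤x)) (s≤s v≤x)) v≤w)))
  (rlmin-map (bump-mono v) w))

rlmin-prepend-> : ∀ {v w x} → x ∈ w → x < v → rlmin (prepend v w) ≡ rlmin w
rlmin-prepend-> {v} {w} {x} x∈w x<v = trans (rlmin-∷ v (map (bump v) w)) (cong₂ _+_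
  (indicator-no (All.all? (v <?_) (map (bump v) w))
    (λ v< → <-asym x<v (subst (v <_) (bump-< x<v) (All.lookup v< (∈-map⁺ (bump v) x∈w)))))
  (rlmin-map (bump-mono v) w))

-- The test is `v ≤ h` rather than `v < h` because a letter equal to `v` is pushed up to `suc v`.
asc-prepend : ∀ v h w → asc (prepend v (h ∷ w)) ≡ indicator (v ≤? h) + asc (h ∷ w)
asc-prepend v h w = trans (asc-∷ v (map (bump v) (h ∷ w))) (cong₂ _+_
  (indicator-cong (v <? bump v h) (v ≤? h) bump->⇒≥ (λ v≤h → subst (v <_) (sym (bump-≥ v≤h)) (s≤s v≤h)))
  (asc-map (bump-mono v) (h ∷ w)))

-- Codes of nonempty permutations: Code n describes permutations of [n + 1].
-- lo, hi and mid i stand for a new first letter 1, n + 2 and 2 + i.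

data Code : ℕ → Set where
  one : Code 0
  lo  : ∀ {n} → Code n → Code (suc n)
  hi  : ∀ {n} → Code n → Code (suc n)
  mid : ∀ {n} → Fin n → Code n → Code (suc n)

prefixed : ∀ {n} → Code n → Word
prefixed one             = [ 1 ]
prefixed (lo c)          = prepend 1 (prefixed c)
prefixed {suc n} (hi c)  = prepend (2 + n) (prefixed c)
prefixed (mid i c)       = prepend (2 + toℕ i) (prefixed c)

prefixed-perm : ∀ {n} (c : Code n) → IsPermutation (suc n) (prefixed c)
prefixed-perm one = ↭-refl
prefixed-perm (lo c) = prepend-perm (s≤s z≤n) (s≤s z≤n) (prefixed-perm c)
prefixed-perm (hi c) = prepend-perm (s≤s z≤n) ≤-refl (prefixed-perm c)
prefixed-perm (mid i c) = prepend-perm (s≤s z≤n) (s≤s (s≤s (<⇒≤ (Fin.toℕ<n i)))) (prefixed-perm c)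

prefixed-surjective : ∀ {n} w → IsPermutation (suc n) w → ∃[ c ] prefixed {n} c ≡ w
prefixed-surjective {zero} w π = one , sym (Perm.↭-singleton-inv π)
prefixed-surjective {suc n} [] π = contradiction (perm⇒length π) λ ()
prefixed-surjective {suc n} (v ∷ w) π with prepend-perm⁻ π | perm⇒bounds π
... | w′ , refl , π′ | (1≤v , v≤2+n) ∷ _ with prefixed-surjective w′ π′ | v | 1≤v
... | c , refl | suc zero | _ = lo c , refl
... | c , refl | suc (suc k) | _ with m≤n⇒m<n∨m≡n v≤2+n
...   | inj₂ refl = hi c , refl
...   | inj₁ (s≤s (s≤s k<n)) = mid (Fin.fromℕ< k<n) c , cong (λ l → prepend (2 + l) (prefixed c)) (Fin.toℕ-fromℕ< k<n)

-- A word a m b with largest letter m, in which the letter 1 lies after m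
-- (front) or before m (back).
data State : Set where
  front back : (a b : Word) → State

assemble : ℕ → State → Word
assemble m (front a b) = a ++ m ∷ b
assemble m (back a b)  = a ++ m ∷ b

-- The largest letter is not stored in the state; it is renumbered by assembling with `suc m` in
-- place of `m`.
insert : ℕ → State → State
insert v (front a b) = front (v ∷ map (bump v) a) (map (bump v) b)
insert v (back a b)  = back (map (bump v) a) (v ∷ map (bump v) b)

state : ∀ {n} → Code n → State
image : ∀ {n} → Code n → Word

-- Here 1 is itself the largest letter and lies on neither side of it, so the tag is a convention;
-- `state-Placed` starts from two letters.
state one       = back [] []
state (lo c)    = back (image c) []
state (hi c)    = front [] (image c)
state (mid i c) = insert (2 + toℕ i) (state c)

image {n} c = assemble (suc n) (state c)

map-bump-++-∷ : ∀ {v m} a b → v ≤ m → map (bump v) (a ++ m ∷ b) ≡ map (bump v) a ++ suc m ∷ map (bump v) b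
map-bump-++-∷ {v} {m} a b v≤m = trans (map-++ (bump v) a (m ∷ b))
  (cong (λ k → map (bump v) a ++ k ∷ map (bump v) b) (bump-≥ v≤m))

insert-↭ : ∀ {v m} s → v ≤ m → assemble (suc m) (insert v s) ↭ prepend v (assemble m s)
insert-↭ {v} (front a b) v≤m = ↭-reflexive (cong (v ∷_) (sym (map-bump-++-∷ a b v≤m)))
insert-↭ {v} {m} (back a b) v≤m = ↭-trans
  (↭-reflexive (sym (++-assoc (map (bump v) a) [ suc m ] (v ∷ map (bump v) b))))
  (↭-trans (shift v (map (bump v) a ++ [ suc m ]) (map (bump v) b))
  (↭-reflexive (cong (v ∷_) (trans (++-assoc (map (bump v) a) [ suc m ] _) (sym (map-bump-++-∷ a b v≤m))))))

perm⇒≤ : ∀ {n w} → IsPermutation n w → All (_< suc n) w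
perm⇒≤ π = All.map (s≤s ∘ proj₂) (perm⇒bounds π)

∷-perm : ∀ {n w} → IsPermutation n w → IsPermutation (suc n) (suc n ∷ w)
∷-perm {n} π = subst (IsPermutation (suc n)) (cong (suc n ∷_) (map-bump-< (perm⇒≤ π))) (prepend-perm (s≤s z≤n) ≤-refl π)

image-perm : ∀ {n} (c : Code n) → IsPermutation (suc n) (image c)
image-perm one = ↭-refl
image-perm {suc n} (lo c) = ↭-trans (↭-sym (Perm.∷↭∷ʳ (2 + n) (image c))) (∷-perm (image-perm c))
image-perm (hi c) = ∷-perm (image-perm c)
image-perm (mid i c) = ↭-trans (insert-↭ (state c) (s≤s (Fin.toℕ<n i)))
  (prepend-perm (s≤s z≤n) (s≤s (s≤s (<⇒≤ (Fin.toℕ<n i)))) (image-perm c))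

-- The invariant by which the assembled word determines the tag, and by which 1 lies where
-- `stateRlm` and `stateLrmaxRight` expect it.
data Placed : State → Set where
  front : ∀ {a b} → All (1 <_) a → Placed (front a b)
  back  : ∀ {a b} → 1 ∈ a → Placed (back a b)

insert-Placed : ∀ k {s} → Placed s → Placed (insert (2 + k) s)
insert-Placed k (front 1<a) = front (s≤s (s≤s z≤n) ∷ All.map⁺ (All.map (λ {x} 1<x → ≤-trans 1<x (x≤bump (2 + k) x)) 1<a))
insert-Placed k (back 1∈a) = back (∈-map⁺ (bump (2 + k)) 1∈a)

state-Placed : ∀ {n} (c : Code (suc n)) → Placed (state c)
state-Placed (lo c) = back (perm⇒∈ (image-perm c) (s≤s z≤n) (s≤s z≤n))
state-Placed (hi c) = front []
state-Placed {suc n} (mid i c) = insert-Placed (toℕ i) (state-Placed c)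

-- Recovering a code from its image.

max-bounds : ∀ {n} a {b} → IsPermutation (suc n) (a ++ suc n ∷ b) → All (_< suc n) a × All (_< suc n) b
max-bounds {n} a {b} π with Unique-++-∷⇒∉ a (perm⇒Unique π) | All.++⁻ a (perm⇒bounds π)
... | m∉a , m∉b | a-bounds , _ ∷ b-bounds = strict m∉a a-bounds , strict m∉b b-bounds
  where
  strict : ∀ {w} → suc n ∉ w → All (λ x → 1 ≤ x × x ≤ suc n) w → All (_< suc n) w
  strict m∉w bounds = All.tabulate λ x∈w → ≤∧≢⇒< (proj₂ (All.lookup bounds x∈w)) λ { refl → m∉w x∈w }

-- Were the marked letters at different positions, each would be strictly larger than the other.
max-split-unique : ∀ a {m b} a′ {m′ b′} → a ++ m ∷ b ≡ a′ ++ m′ ∷ b′ →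
  All (_< m) a → All (_< m) b → All (_< m′) a′ → All (_< m′) b′ → a ≡ a′ × m ≡ m′ × b ≡ b′
max-split-unique [] [] refl _ _ _ _ = refl , refl , refl
max-split-unique [] (x ∷ a′) refl _ b<m (m<m′ ∷ _) _ = contradiction m<m′ (<-asym (All.lookup b<m (∈-++⁺ʳ a′ (here refl))))
max-split-unique (x ∷ a) [] refl (m′<m ∷ _) _ _ b′<m′ = contradiction m′<m (<-asym (All.lookup b′<m′ (∈-++⁺ʳ a (here refl))))
max-split-unique (x ∷ a) (x′ ∷ a′) eq (_ ∷ a<m) b<m (_ ∷ a′<m′) b′<m′ with ∷-injective eq
... | refl , eq′ with max-split-unique a a′ eq′ a<m b<m a′<m′ b′<m′
...   | refl , m≡m′ , b≡b′ = refl , m≡m′ , b≡b′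

assemble-injective : ∀ {n s s′} → Placed s → Placed s′ → IsPermutation (suc n) (assemble (suc n) s) →
  IsPermutation (suc n) (assemble (suc n) s′) → assemble (suc n) s ≡ assemble (suc n) s′ → s ≡ s′
assemble-injective {n} {s} {s′} p p′ π π′ eq = go p p′ π π′ eq
  where
  same : ∀ a {b} a′ {b′} → IsPermutation (suc n) (a ++ suc n ∷ b) → IsPermutation (suc n) (a′ ++ suc n ∷ b′) →
         a ++ suc n ∷ b ≡ a′ ++ suc n ∷ b′ → a ≡ a′ × b ≡ b′
  same a a′ π π′ eq with max-bounds a π | max-bounds a′ π′
  ... | a< , b< | a′< , b′< with max-split-unique a a′ eq a< b< a′< b′<
  ...   | a≡a′ , _ , b≡b′ = a≡a′ , b≡b′
  go : ∀ {s s′} → Placed s → Placed s′ → IsPermutation (suc n) (assemble (suc n) s) →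
       IsPermutation (suc n) (assemble (suc n) s′) → assemble (suc n) s ≡ assemble (suc n) s′ → s ≡ s′
  go {front a _} {front a′ _} _ _ π π′ eq with same a a′ π π′ eq
  ... | refl , refl = refl
  go {back a _} {back a′ _} _ _ π π′ eq with same a a′ π π′ eq
  ... | refl , refl = refl
  go {front a _} {back a′ _} (front 1<a) (back 1∈a′) π π′ eq with same a a′ π π′ eq
  ... | refl , _ = contradiction (All.lookup 1<a 1∈a′) (<-irrefl refl)
  go {back a _} {front a′ _} (back 1∈a) (front 1<a′) π π′ eq with same a a′ π π′ eq
  ... | refl , _ = contradiction (All.lookup 1<a′ 1∈a) (<-irrefl refl)

front-injective : ∀ {a b a′ b′} → State.front a b ≡ front a′ b′ → a ≡ a′ × b ≡ b′
front-injective refl = refl , refl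

back-injective : ∀ {a b a′ b′} → State.back a b ≡ back a′ b′ → a ≡ a′ × b ≡ b′
back-injective refl = refl , refl

insert-injective : ∀ {v v′} s s′ → insert v s ≡ insert v′ s′ → v ≡ v′ × s ≡ s′
insert-injective {v} (front a b) (front a′ b′) eq with front-injective eq
... | a≡ , b≡ with ∷-injective a≡
... | refl , a≡′ = refl , cong₂ front (map-injective (bump-injective v) a≡′) (map-injective (bump-injective v) b≡)
insert-injective {v} (back a b) (back a′ b′) eq with back-injective eq
... | a≡ , b≡ with ∷-injective b≡
... | refl , b≡′ = refl , cong₂ back (map-injective (bump-injective v) a≡) (map-injective (bump-injective v) b≡′)

insert≢front[] : ∀ {v b} s → insert v s ≢ front [] b
insert≢front[] (front _ _) ()
insert≢front[] (back _ _) ()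

insert≢back[] : ∀ {v a} s → insert v s ≢ back a []
insert≢back[] (front _ _) ()
insert≢back[] (back _ _) ()

-- The state reveals the last constructor: `hi` leaves nothing before the largest letter and `lo`
-- nothing after it, whereas `mid` puts its letter exactly there. The tag separates `hi` from `lo`.
state-injective : ∀ {n} (c c′ : Code n) → state c ≡ state c′ → c ≡ c′
image-injective : ∀ {n} (c c′ : Code n) → image c ≡ image c′ → c ≡ c′

state-injective one one _ = refl
state-injective (lo c) (lo c′) eq = cong lo (image-injective c c′ (proj₁ (back-injective eq)))
state-injective (hi c) (hi c′) eq = cong hi (image-injective c c′ (proj₂ (front-injective eq)))
state-injective (lo c) (mid i c′) eq = contradiction (sym eq) (insert≢back[] (state c′))
state-injective (hi c) (mid i c′) eq = contradiction (sym eq) (insert≢front[] (state c′))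
state-injective (mid i c) (lo c′) eq = contradiction eq (insert≢back[] (state c))
state-injective (mid i c) (hi c′) eq = contradiction eq (insert≢front[] (state c))
state-injective (mid i c) (mid i′ c′) eq with insert-injective (state c) (state c′) eq
... | v≡v′ , s≡s′ = cong₂ mid (Fin.toℕ-injective (suc-injective (suc-injective v≡v′))) (state-injective c c′ s≡s′)

image-injective {zero} one one _ = refl
image-injective {suc n} c c′ eq = state-injective c c′
  (assemble-injective (state-Placed c) (state-Placed c′) (image-perm c) (image-perm c′) eq)

-- Statistics of the image

-- Renumbering at `2 + k` fixes 0 and 1 and keeps all other letters above 1.
leftOf1-bump : ∀ k w → leftOf1 (map (bump (2 + k)) w) ≡ map (bump (2 + k)) (leftOf1 w)
leftOf1-bump k [] = refl
leftOf1-bump k (zero ∷ w) = cong (zero ∷_) (leftOf1-bump k w)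
leftOf1-bump k (suc zero ∷ w) = refl
leftOf1-bump k (suc (suc x) ∷ w) = cong (2 + bump k x ∷_) (leftOf1-bump k w)

rightOf1-bump : ∀ k w → rightOf1 (map (bump (2 + k)) w) ≡ map (bump (2 + k)) (rightOf1 w)
rightOf1-bump k [] = refl
rightOf1-bump k (zero ∷ w) = rightOf1-bump k w
rightOf1-bump k (suc zero ∷ w) = refl
rightOf1-bump k (suc (suc x) ∷ w) = rightOf1-bump k w

rlm-bump : ∀ k w → rlm (map (bump (2 + k)) w) ≡ rlm w
rlm-bump k w = trans (cong rlmax (leftOf1-bump k w)) (rlmax-map (bump-mono (2 + k)) (leftOf1 w))

lrmaxRight-bump : ∀ k w → lrmaxRight (map (bump (2 + k)) w) ≡ lrmaxRight w
lrmaxRight-bump k w = cong suc (trans (cong (lrmax 0) (rightOf1-bump k w)) (lrmax-map (bump-mono (2 + k)) 0 (rightOf1 w)))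

-- In a `front` word the largest letter hides `a` and counts once itself; in a `back` word
-- everything left of 1 lies in `a`.
stateRlm : State → ℕ
stateRlm (front a b) = suc (rlm b)
stateRlm (back a b)  = rlm a

-- In a `front` word everything right of 1 lies in `b`; in a `back` word the largest letter is the
-- last left-to-right maximum, so `b` contributes nothing.
stateLrmaxRight : State → ℕ
stateLrmaxRight (front a b) = lrmaxRight b
stateLrmaxRight (back a b)  = suc (lrmaxRight a)

-- The inserted letter enters the half that the formula does not read, so only the renumbering of
-- the other half matters.
stateRlm-insert : ∀ k s → stateRlm (insert (2 + k) s) ≡ stateRlm s
stateRlm-insert k (front a b) = cong suc (rlm-bump k b)
stateRlm-insert k (back a b) = rlm-bump k a

stateLrmaxRight-insert : ∀ k s → stateLrmaxRight (insert (2 + k) s) ≡ stateLrmaxRight s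
stateLrmaxRight-insert k (front a b) = lrmaxRight-bump k b
stateLrmaxRight-insert k (back a b) = cong suc (lrmaxRight-bump k a)

rlm-assemble : ∀ {n s} → Placed s → IsPermutation (2 + n) (assemble (2 + n) s) → rlm (assemble (2 + n) s) ≡ stateRlm s
rlm-assemble {n} {front a b} (front 1<a) π = trans
  (cong rlmax (leftOf1-++ʳ a (2 + n ∷ b) 1<a))
  (rlmax-++-max a (proj₁ (max-bounds a π)) (All.takeWhile⁺ _ (proj₂ (max-bounds a π))))
rlm-assemble {n} {back a b} (back 1∈a) π = cong rlmax (leftOf1-++ˡ a (2 + n ∷ b) 1∈a)

lrmaxRight-assemble : ∀ {n s} → Placed s → IsPermutation (2 + n) (assemble (2 + n) s) →
  lrmaxRight (assemble (2 + n) s) ≡ stateLrmaxRight s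
lrmaxRight-assemble {n} {front a b} (front 1<a) π = cong (suc ∘ lrmax 0) (rightOf1-++ʳ a (2 + n ∷ b) 1<a)
lrmaxRight-assemble {n} {back a b} (back 1∈a) π with max-bounds a π
... | a<m , b<m = cong suc (begin
  lrmax 0 (rightOf1 (a ++ 2 + n ∷ b))                ≡⟨ cong (lrmax 0) (rightOf1-++ˡ a (2 + n ∷ b) 1∈a) ⟩
  lrmax 0 (rightOf1 a ++ 2 + n ∷ b)                  ≡⟨ lrmax-++-max (rightOf1 a) b (s≤s z≤n) (rightOf1-All a a<m) ⟩
  lrmax 0 (rightOf1 a) + suc (lrmax (2 + n) b)       ≡⟨ cong (λ l → lrmax 0 (rightOf1 a) + suc l) lrmax-b≡0 ⟩
  lrmax 0 (rightOf1 a) + 1                           ≡⟨ +-comm (lrmax 0 (rightOf1 a)) 1 ⟩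
  suc (lrmax 0 (rightOf1 a))                         ∎)
  where
  open ≡-Reasoning
  lrmax-b≡0 : lrmax (2 + n) b ≡ 0
  lrmax-b≡0 = trans (cong (lrmax (2 + n)) (sym (++-identityʳ b))) (lrmax-below b [] b<m)

-- The letter that a newly inserted letter precedes, with 1 as a sentinel for
-- the end of the word.
follower : ℕ → State → ℕ
follower m (front [] b)      = m
follower m (front (x ∷ a) b) = x
follower m (back a [])       = 1
follower m (back a (x ∷ b))  = x

follower-insert : ∀ m v s → follower m (insert v s) ≡ v
follower-insert m v (front a b) = refl
follower-insert m v (back a b) = refl

-- The invariant that synchronises ascents: a further intermediate letter is compared with the same
-- letter in both words.
prefixed-head : ∀ {n} (c : Code n) → ∃[ w ] prefixed c ≡ follower (suc n) (state c) ∷ w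
prefixed-head one = _ , refl
prefixed-head (lo c) = _ , refl
prefixed-head (hi c) = _ , refl
prefixed-head {suc n} (mid i c) =
  map (bump (2 + toℕ i)) (prefixed c) , cong (_∷ map (bump (2 + toℕ i)) (prefixed c)) (sym (follower-insert (2 + n) (2 + toℕ i) (state c)))

-- In a `back` word the new letter stands just after the largest one, which starts no ascent either
-- before or after the insertion. Hence only the comparison with the follower counts.
asc-insert : ∀ {n k s} → k ≤ n → IsPermutation (2 + n) (assemble (2 + n) s) →
  asc (assemble (3 + n) (insert (2 + k) s)) ≡ indicator (2 + k ≤? follower (2 + n) s) + asc (assemble (2 + n) s)
asc-insert {n} {k} {front [] b} k≤n _ = trans
  (cong (λ u → asc (2 + k ∷ u)) (sym (map-bump-++-∷ [] b (s≤s (s≤s k≤n))))) (asc-prepend (2 + k) (2 + n) b)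
asc-insert {n} {k} {front (x ∷ a) b} k≤n _ = trans
  (cong (λ u → asc (2 + k ∷ u)) (sym (map-bump-++-∷ (x ∷ a) b (s≤s (s≤s k≤n))))) (asc-prepend (2 + k) x (a ++ 2 + n ∷ b))
asc-insert {n} {k} {s@(back a b)} k≤n π with max-bounds a π
... | a<m , b<m = begin
  asc (map β a ++ 3 + n ∷ v ∷ map β b)                ≡⟨ asc-++-∷ (map β a) (3 + n) (v ∷ map β b) ⟩
  asc (map β a ++ [ 3 + n ]) + asc (3 + n ∷ v ∷ map β b) ≡⟨ cong₂ _+_ left right ⟩
  asc (a ++ [ 2 + n ]) + (ι + asc b)                  ≡⟨ +-assoc (asc (a ++ [ 2 + n ])) ι (asc b) ⟨
  asc (a ++ [ 2 + n ]) + ι + asc b                    ≡⟨ cong (_+ asc b) (+-comm (asc (a ++ [ 2 + n ])) ι) ⟩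
  ι + asc (a ++ [ 2 + n ]) + asc b                    ≡⟨ +-assoc ι (asc (a ++ [ 2 + n ])) (asc b) ⟩
  ι + (asc (a ++ [ 2 + n ]) + asc b)                  ≡⟨ cong (λ l → ι + (asc (a ++ [ 2 + n ]) + l)) (asc-∷-max b<m) ⟨
  ι + (asc (a ++ [ 2 + n ]) + asc (2 + n ∷ b))        ≡⟨ cong (ι +_) (asc-++-∷ a (2 + n) b) ⟨
  ι + asc (a ++ 2 + n ∷ b)                            ∎
  where
  open ≡-Reasoning
  v = 2 + k
  β = bump v
  ι = indicator (v ≤? follower (2 + n) s)
  left : asc (map β a ++ [ 3 + n ]) ≡ asc (a ++ [ 2 + n ])
  left = trans (cong asc (sym (map-bump-++-∷ a [] (s≤s (s≤s k≤n))))) (asc-map (bump-mono v) (a ++ [ 2 + n ]))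
  after : ∀ b → asc (v ∷ map β b) ≡ indicator (v ≤? follower (2 + n) (back a b)) + asc b
  -- At the end of the word the sentinel 1 is below `v = 2 + k`, so the indicator vanishes.
  after [] = refl
  after (x ∷ b) = asc-prepend v x b
  right : asc (3 + n ∷ v ∷ map β b) ≡ ι + asc b
  right = trans (asc-∷-max (s≤s (s≤s (s≤s k≤n)) ∷ All.map⁺ (All.map (λ {x} x<m → ≤-trans (s≤s (bump≤1+x v x)) (s≤s x<m)) b<m))) (after b)

-- Agreement of the statistics of the two words of a code.

asc-snoc-perm : ∀ {n w} → IsPermutation (suc n) w → asc (w ++ [ 2 + n ]) ≡ suc (asc w)
asc-snoc-perm {w = []} π = contradiction (perm⇒length π) λ ()
asc-snoc-perm {w = x ∷ w} π = asc-∷ʳ-max x w (perm⇒≤ π)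

1≤1+n : ∀ {n} → 1 ≤ suc n
1≤1+n = s≤s z≤n

-- Only `hi` creates a right-to-left maximum; letters added by `lo` and `mid` stand left of a larger
-- one. On the other side only `hi` puts a new largest letter before 1.
prefixed-rlmax : ∀ {n} (c : Code n) → rlmax (prefixed c) ≡ suc (rlm (image c))
prefixed-rlmax one = refl
prefixed-rlmax (lo c) = trans (rlmax-prepend-≤ (perm⇒∈ (prefixed-perm c) 1≤1+n 1≤1+n) 1≤1+n)
  (trans (prefixed-rlmax c) (cong suc (sym (rlm-assemble (state-Placed (lo c)) (image-perm (lo c))))))
prefixed-rlmax (hi c) = trans (rlmax-prepend-max (perm⇒≤ (prefixed-perm c)))
  (cong suc (trans (prefixed-rlmax c) (sym (rlm-assemble (state-Placed (hi c)) (image-perm (hi c))))))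
-- The index `i` exists only if `c` codes at least two letters, so `state-Placed` applies to `c`.
prefixed-rlmax {suc (suc n)} (mid i c) = begin
  rlmax (prefixed (mid i c))               ≡⟨ rlmax-prepend-≤ (perm⇒∈ (prefixed-perm c) 1≤1+n ≤-refl) (s≤s (Fin.toℕ<n i)) ⟩
  rlmax (prefixed c)                       ≡⟨ prefixed-rlmax c ⟩
  suc (rlm (image c))                      ≡⟨ cong suc (rlm-assemble (state-Placed c) (image-perm c)) ⟩
  suc (stateRlm (state c))                 ≡⟨ cong suc (stateRlm-insert (toℕ i) (state c)) ⟨
  suc (stateRlm (state (mid i c)))         ≡⟨ cong suc (rlm-assemble (state-Placed (mid i c)) (image-perm (mid i c))) ⟨
  suc (rlm (image (mid i c)))              ∎
  where open ≡-Reasoning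

prefixed-rlmin : ∀ {n} (c : Code n) → rlmin (prefixed c) ≡ lrmaxRight (image c)
prefixed-rlmin one = refl
prefixed-rlmin (lo c) = trans (rlmin-prepend-min (All.map proj₁ (perm⇒bounds (prefixed-perm c))))
  (trans (cong suc (prefixed-rlmin c)) (sym (lrmaxRight-assemble (state-Placed (lo c)) (image-perm (lo c)))))
prefixed-rlmin (hi c) = trans (rlmin-prepend-> (perm⇒∈ (prefixed-perm c) ≤-refl 1≤1+n) (s≤s 1≤1+n))
  (trans (prefixed-rlmin c) (sym (lrmaxRight-assemble (state-Placed (hi c)) (image-perm (hi c)))))
prefixed-rlmin {suc (suc n)} (mid i c) = begin
  rlmin (prefixed (mid i c))               ≡⟨ rlmin-prepend-> (perm⇒∈ (prefixed-perm c) ≤-refl 1≤1+n) (s≤s 1≤1+n) ⟩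
  rlmin (prefixed c)                       ≡⟨ prefixed-rlmin c ⟩
  lrmaxRight (image c)                     ≡⟨ lrmaxRight-assemble (state-Placed c) (image-perm c) ⟩
  stateLrmaxRight (state c)                ≡⟨ stateLrmaxRight-insert (toℕ i) (state c) ⟨
  stateLrmaxRight (state (mid i c))        ≡⟨ lrmaxRight-assemble (state-Placed (mid i c)) (image-perm (mid i c)) ⟨
  lrmaxRight (image (mid i c))             ∎
  where open ≡-Reasoning

asc-prepend-prefixed : ∀ {n} v (c : Code n) →
  asc (prepend v (prefixed c)) ≡ indicator (v ≤? follower (suc n) (state c)) + asc (prefixed c)
asc-prepend-prefixed v c with prefixed c | prefixed-head c
... | _ | w , refl = asc-prepend v _ w

follower-bounds : ∀ {n} (c : Code n) → 1 ≤ follower (suc n) (state c) × follower (suc n) (state c) ≤ suc n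
follower-bounds c with prefixed-head c | perm⇒bounds (prefixed-perm c)
... | w , eq | bounds = All.head (subst (All _) eq bounds)

-- A smallest first letter always gives an ascent, as does a largest letter at the end of the image;
-- a largest first letter gives none on either side. For `mid` both sides test the follower.
prefixed-asc : ∀ {n} (c : Code n) → asc (prefixed c) ≡ asc (image c)
prefixed-asc one = refl
prefixed-asc {suc n} (lo c) = begin
  asc (prepend 1 (prefixed c))             ≡⟨ asc-prepend-prefixed 1 c ⟩
  indicator (1 ≤? follower (suc n) (state c)) + asc (prefixed c)
                                           ≡⟨ cong (_+ asc (prefixed c)) (indicator-yes (1 ≤? _) (proj₁ (follower-bounds c))) ⟩
  suc (asc (prefixed c))                   ≡⟨ cong suc (prefixed-asc c) ⟩
  suc (asc (image c))                      ≡⟨ asc-snoc-perm (image-perm c) ⟨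
  asc (image c ++ [ 2 + n ])               ∎
  where open ≡-Reasoning
prefixed-asc {suc n} (hi c) = begin
  asc (prepend (2 + n) (prefixed c))       ≡⟨ asc-prepend-prefixed (2 + n) c ⟩
  indicator (2 + n ≤? follower (suc n) (state c)) + asc (prefixed c)
                                           ≡⟨ cong (_+ asc (prefixed c)) (indicator-no (2 + n ≤? _) (≤⇒≯ (proj₂ (follower-bounds c)))) ⟩
  asc (prefixed c)                         ≡⟨ prefixed-asc c ⟩
  asc (image c)                            ≡⟨ asc-∷-max (perm⇒≤ (image-perm c)) ⟨
  asc (2 + n ∷ image c)                    ∎
  where open ≡-Reasoning
prefixed-asc {suc (suc n)} (mid i c) = begin
  asc (prepend (2 + toℕ i) (prefixed c))   ≡⟨ asc-prepend-prefixed (2 + toℕ i) c ⟩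
  ι + asc (prefixed c)                     ≡⟨ cong (ι +_) (prefixed-asc c) ⟩
  ι + asc (image c)                        ≡⟨ asc-insert {s = state c} (s≤s⁻¹ (Fin.toℕ<n i)) (image-perm c) ⟨
  asc (image (mid i c))                    ∎
  where
  open ≡-Reasoning
  ι = indicator (2 + toℕ i ≤? follower (2 + n) (state c))

∈-S⇒perm : ∀ {n w} → w ∈ S n → IsPermutation n w
∈-S⇒perm {n} {w} = Equivalence.to (∈-S n w)

∷-cong₃ : {a b c a′ b′ c′ : ℕ} → a ≡ a′ → b ≡ b′ → c ≡ c′ → a ∷ b ∷ c ∷ [] ≡ Vec._∷_ a′ (b′ ∷ c′ ∷ [])
∷-cong₃ refl refl refl = refl

rlmax-rlmin~rlm-lrmaxRight : ∀ n → EquallyDistributed (S (suc n)) (rlmax-1 ∷ rlmin ∷ asc ∷ []) (rlm ∷ lrmaxRight ∷ asc ∷ [])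
rlmax-rlmin~rlm-lrmaxRight n = equallyDistributed-via (S-unique (suc n)) _ _ prefixed image
  (λ {w} w∈S → prefixed-surjective w (∈-S⇒perm w∈S))
  (λ c → Equivalence.from (∈-S (suc n) (image c)) (image-perm c))
  (λ {c} {c′} eq → cong prefixed (image-injective c c′ eq))
  (λ c → ∷-cong₃ (cong (_∸ 1) (prefixed-rlmax c)) (prefixed-rlmin c) (prefixed-asc c))

-- Splitting at the letter 1

min-bounds : ∀ {n} L {R} → IsPermutation n (L ++ 1 ∷ R) → All (1 <_) L × All (1 <_) R
min-bounds L π with Unique-++-∷⇒∉ L (perm⇒Unique π) | All.++⁻ L (perm⇒bounds π)
... | 1∉L , 1∉R | L-bounds , _ ∷ R-bounds = strict 1∉L L-bounds , strict 1∉R R-bounds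
  where
  strict : ∀ {n w} → 1 ∉ w → All (λ x → 1 ≤ x × x ≤ n) w → All (1 <_) w
  strict 1∉w bounds = All.tabulate λ x∈w → ≤∧≢⇒< (proj₁ (All.lookup bounds x∈w)) λ { refl → 1∉w x∈w }

split-at-1 : ∀ {n w} → IsPermutation (suc n) w → ∃[ L ] ∃[ R ] w ≡ L ++ 1 ∷ R
split-at-1 π = ∈-∃++ (perm⇒∈ π ≤-refl (s≤s z≤n))

rlm-split : ∀ {n} L {R} → IsPermutation n (L ++ 1 ∷ R) → rlm (L ++ 1 ∷ R) ≡ rlmax L
rlm-split L {R} π = cong rlmax (leftOf1-split L R (proj₁ (min-bounds L π)))

lrmaxRight-split : ∀ {n} L {R} → IsPermutation n (L ++ 1 ∷ R) → lrmaxRight (L ++ 1 ∷ R) ≡ suc (lrmax 0 R)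
lrmaxRight-split L {R} π = cong (suc ∘ lrmax 0) (rightOf1-split L R (proj₁ (min-bounds L π)))

split-at-1-unique : ∀ {n} L {R} L′ {R′} → IsPermutation n (L ++ 1 ∷ R) → IsPermutation n (L′ ++ 1 ∷ R′) →
  L ++ 1 ∷ R ≡ L′ ++ 1 ∷ R′ → L ≡ L′ × R ≡ R′
split-at-1-unique L {R} L′ {R′} π π′ eq =
  trans (sym (leftOf1-split L R 1<L)) (trans (cong leftOf1 eq) (leftOf1-split L′ R′ 1<L′)) ,
  trans (sym (rightOf1-split L R 1<L)) (trans (cong rightOf1 eq) (rightOf1-split L′ R′ 1<L′))
  where
  1<L = proj₁ (min-bounds L π)
  1<L′ = proj₁ (min-bounds L′ π′)

-- The reverse complement of the letters to the right of 1

assoc : Word → Word → ℕ → ℕ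
assoc (x ∷ xs) (y ∷ ys) z with z ≟ x
... | yes _ = y
... | no _  = assoc xs ys z
assoc _ _ z = z

assoc-∈ : ∀ xs ys {z} → length xs ≡ length ys → z ∈ xs → assoc xs ys z ∈ ys
assoc-∈ (x ∷ xs) (y ∷ ys) {z} len z∈ with z ≟ x
assoc-∈ (x ∷ xs) (y ∷ ys) {z} len z∈ | yes _ = here refl
assoc-∈ (x ∷ xs) (y ∷ ys) {z} len (here z≡x) | no z≢x = contradiction z≡x z≢x
assoc-∈ (x ∷ xs) (y ∷ ys) {z} len (there z∈) | no _ = there (assoc-∈ xs ys (suc-injective len) z∈)

AntitoneOn : (ℕ → ℕ) → Word → Set
AntitoneOn f w = ∀ {x y} → x ∈ w → y ∈ w → x < y → f y < f x

assoc-antitone : ∀ {xs ys} → length xs ≡ length ys → AllPairs _<_ xs → AllPairs _>_ ys → AntitoneOn (assoc xs ys) xs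
assoc-antitone {x ∷ xs} {y ∷ ys} len (x<xs ∷ xs↗) (y>ys ∷ ys↘) {z} {z′} z∈ z′∈ z<z′ with z ≟ x | z′ ≟ x | z∈ | z′∈
... | yes refl | yes refl | _ | _ = contradiction z<z′ (<-irrefl refl)
... | yes refl | no z′≢x | _ | here z′≡x = contradiction z′≡x z′≢x
... | yes refl | no _ | _ | there z′∈xs = All.lookup y>ys (assoc-∈ xs ys (suc-injective len) z′∈xs)
... | no z≢x | _ | here z≡x | _ = contradiction z≡x z≢x
... | no _ | yes refl | there z∈xs | _ = contradiction z<z′ (<-asym (All.lookup x<xs z∈xs))
... | no _ | no z′≢x | there _ | here z′≡x = contradiction z′≡x z′≢x
... | no _ | no _ | there z∈xs | there z′∈xs = assoc-antitone (suc-injective len) xs↗ ys↘ z∈xs z′∈xs z<z′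

AllPairs-reverse⁺ : ∀ {w} → AllPairs _<_ w → AllPairs _>_ (reverse w)
AllPairs-reverse⁺ [] = []
AllPairs-reverse⁺ {x ∷ w} (x<w ∷ w↗) = subst (AllPairs _>_) (sym (unfold-reverse x w))
  (AllPairs.++⁺ (AllPairs-reverse⁺ w↗) ([] ∷ []) (All.tabulate λ y∈ → All.lookup x<w (∈-resp-↭ (Perm.↭-reverse w) y∈) ∷ []))

module _ {f : ℕ → ℕ} where

  antitone-reflects-< : ∀ {w x y} → AntitoneOn f w → x ∈ w → y ∈ w → f y < f x → x < y
  antitone-reflects-< {x = x} {y} anti x∈ y∈ fy<fx with <-cmp x y
  ... | tri< x<y _ _ = x<y
  ... | tri≈ _ refl _ = contradiction fy<fx (<-irrefl refl)
  ... | tri> _ _ y<x = contradiction fy<fx (<-asym (anti y∈ x∈ y<x))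

  antitone-injective : ∀ {w x y} → AntitoneOn f w → x ∈ w → y ∈ w → f x ≡ f y → x ≡ y
  antitone-injective {x = x} {y} anti x∈ y∈ eq with <-cmp x y
  ... | tri< x<y _ _ = contradiction (sym eq) (<⇒≢ (anti x∈ y∈ x<y))
  ... | tri≈ _ x≡y _ = x≡y
  ... | tri> _ _ y<x = contradiction eq (<⇒≢ (anti y∈ x∈ y<x))

  map-injective-on : ∀ {s} u v → (∀ {x y} → x ∈ s → y ∈ s → f x ≡ f y → x ≡ y) → u ⊆ s → v ⊆ s → map f u ≡ map f v → u ≡ v
  map-injective-on [] [] _ _ _ _ = refl
  map-injective-on (x ∷ u) (y ∷ v) inj u⊆s v⊆s eq with ∷-injective eq
  ... | fx≡fy , eq′ = cong₂ _∷_ (inj (u⊆s (here refl)) (v⊆s (here refl)) fx≡fy)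
    (map-injective-on u v inj (u⊆s ∘ there) (v⊆s ∘ there) eq′)

  Unique-map-on : ∀ {w} → (∀ {x y} → x ∈ w → y ∈ w → f x ≡ f y → x ≡ y) → Unique w → Unique (map f w)
  Unique-map-on inj [] = []
  Unique-map-on inj (x∉w ∷ w!) =
    All.map⁺ (All.tabulate λ y∈w eq → All.lookup x∉w y∈w (inj (here refl) (there y∈w) eq)) ∷
    Unique-map-on (λ x∈ y∈ → inj (there x∈) (there y∈)) w!

  -- Reversal turns suffixes into prefixes and an antitone map turns minima into maxima.
  lrmax-reverse-map : ∀ w → AntitoneOn f w → All (λ x → 0 < f x) w → lrmax 0 (reverse (map f w)) ≡ rlmin w
  lrmax-reverse-map [] _ _ = refl
  lrmax-reverse-map (x ∷ w) anti (0<fx ∷ 0<f) = begin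
    lrmax 0 (reverse (map f (x ∷ w)))   ≡⟨ cong (lrmax 0) (unfold-reverse (f x) (map f w)) ⟩
    lrmax 0 (r ++ [ f x ])              ≡⟨ lrmax-++ 0 r [ f x ] ⟩
    lrmax 0 r + (ι + 0)                 ≡⟨ cong (lrmax 0 r +_) (+-identityʳ ι) ⟩
    lrmax 0 r + ι                       ≡⟨ cong₂ _+_ (lrmax-reverse-map w (λ y∈ z∈ → anti (there y∈) (there z∈)) 0<f) ι≡ ⟩
    rlmin w + indicator (All.all? (x <?_) w)  ≡⟨ +-comm (rlmin w) _ ⟩
    indicator (All.all? (x <?_) w) + rlmin w  ≡⟨ rlmin-∷ x w ⟨
    rlmin (x ∷ w)                       ∎
    where
    open ≡-Reasoning
    r = reverse (map f w)
    ι = indicator (maximum 0 r <? f x)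
    ι≡ : ι ≡ indicator (All.all? (x <?_) w)
    ι≡ = indicator-cong (maximum 0 r <? f x) (All.all? (x <?_) w)
      (λ max<fx → All.tabulate λ y∈w → antitone-reflects-< anti (here refl) (there y∈w)
        (All.lookup (proj₂ (maximum-<⁻ r max<fx)) (∈-resp-↭ (↭-sym (Perm.↭-reverse (map f w))) (∈-map⁺ f y∈w))))
      (λ x<w → maximum-< r 0<fx (Perm.All-resp-↭ (↭-sym (Perm.↭-reverse (map f w)))
        (All.map⁺ (All.tabulate λ y∈w → anti (here refl) (there y∈w) (All.lookup x<w y∈w)))))

  -- Reversal and an antitone map each exchange ascents with descents.
  asc-reverse-map : ∀ w → AntitoneOn f w → asc (reverse (map f w)) ≡ asc w
  asc-reverse-map [] _ = refl
  asc-reverse-map (x ∷ []) _ = refl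
  asc-reverse-map (x ∷ y ∷ w) anti = begin
    asc (reverse (f x ∷ f y ∷ map f w))          ≡⟨ cong asc (trans (unfold-reverse (f x) (f y ∷ map f w)) (cong (_∷ʳ f x) (unfold-reverse (f y) (map f w)))) ⟩
    asc ((r ∷ʳ f y) ∷ʳ f x)                      ≡⟨ cong asc (++-assoc r [ f y ] [ f x ]) ⟩
    asc (r ++ f y ∷ [ f x ])                     ≡⟨ asc-++-∷ r (f y) [ f x ] ⟩
    asc (r ∷ʳ f y) + asc (f y ∷ [ f x ])         ≡⟨ cong₂ _+_ (cong asc (sym (unfold-reverse (f y) (map f w)))) (trans (asc-∷ (f y) [ f x ]) (+-identityʳ _)) ⟩
    asc (reverse (map f (y ∷ w))) + indicator (f y <? f x) ≡⟨ cong₂ _+_ (asc-reverse-map (y ∷ w) (λ u∈ v∈ → anti (there u∈) (there v∈))) ι≡ ⟩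
    asc (y ∷ w) + indicator (x <? y)             ≡⟨ +-comm (asc (y ∷ w)) _ ⟩
    indicator (x <? y) + asc (y ∷ w)             ≡⟨ asc-∷ x (y ∷ w) ⟨
    asc (x ∷ y ∷ w)                              ∎
    where
    open ≡-Reasoning
    r = reverse (map f w)
    ι≡ : indicator (f y <? f x) ≡ indicator (x <? y)
    ι≡ = indicator-cong (f y <? f x) (x <? y)
      (antitone-reflects-< anti (here refl) (there (here refl))) (anti (here refl) (there (here refl)))

asc-∷-min-cong : ∀ {m} u v → All (m <_) u → All (m <_) v → length u ≡ length v → asc u ≡ asc v → asc (m ∷ u) ≡ asc (m ∷ v)
asc-∷-min-cong [] [] _ _ _ _ = refl
asc-∷-min-cong (x ∷ u) (y ∷ v) (m<x ∷ _) (m<y ∷ _) _ eq = trans (asc-∷-min m<x) (trans (cong suc eq) (sym (asc-∷-min m<y)))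

-- The letters of R in a permutation L 1 R of [n], computed from L.
support : ℕ → Word → Word
support n L = filter (λ x → ¬? (x ∈? (1 ∷ L))) [1⋯ n ]

-- The support is listed in increasing order, so its `i`-th smallest letter is sent to its `i`-th
-- largest. Only `L` enters, which the map on permutations keeps.
opposite : ℕ → Word → ℕ → ℕ
opposite n L = assoc (support n L) (reverse (support n L))

opposite-antitone : ∀ n L → AntitoneOn (opposite n L) (support n L)
opposite-antitone n L = assoc-antitone (sym (length-reverse (support n L))) support↗ (AllPairs-reverse⁺ support↗)
  where
  support↗ : AllPairs _<_ (support n L)
  support↗ = AllPairs.filter⁺ _ (AllPairs.map⁺ (AllPairs.applyUpTo⁺₁ id n (λ i<j _ → s≤s i<j)))

opposite-∈ : ∀ n L {x} → x ∈ support n L → opposite n L x ∈ support n L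
opposite-∈ n L x∈ = ∈-resp-↭ (Perm.↭-reverse (support n L)) (assoc-∈ _ _ (sym (length-reverse (support n L))) x∈)

record Cut (n : ℕ) : Set where
  field
    L R  : Word
    perm : IsPermutation n (L ++ 1 ∷ R)

  word! : Unique (L ++ 1 ∷ R)
  word! = perm⇒Unique perm

  R⊆support : R ⊆ support n L
  R⊆support {x} x∈R = ∈-filter⁺ _ (∈-resp-↭ perm (∈-++⁺ʳ L (there x∈R))) x∉
    where
    x∉ : x ∉ 1 ∷ L
    x∉ (here refl) = <-irrefl refl (All.lookup (proj₂ (min-bounds L perm)) x∈R)
    x∉ (there x∈L) = Unique-++⇒∉ L word! x∈L (there x∈R)

  support⊆R : support n L ⊆ R
  support⊆R x∈ with ∈-filter⁻ (λ x → ¬? (x ∈? (1 ∷ L))) {xs = [1⋯ n ]} x∈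
  ... | x∈[n] , x∉ with ∈-++⁻ L (∈-resp-↭ (↭-sym perm) x∈[n])
  ... | inj₁ x∈L = contradiction (there x∈L) x∉
  ... | inj₂ (here refl) = contradiction (here refl) x∉
  ... | inj₂ (there x∈R) = x∈R

  f : ℕ → ℕ
  f = opposite n L

  f-antitone : AntitoneOn f R
  f-antitone x∈ y∈ = opposite-antitone n L (R⊆support x∈) (R⊆support y∈)

  f-∈ : ∀ {x} → x ∈ R → f x ∈ R
  f-∈ x∈R = support⊆R (opposite-∈ n L (R⊆support x∈R))

  R′ : Word
  R′ = reverse (map f R)

  R′↭R : R′ ↭ R
  R′↭R = ↭-trans (Perm.↭-reverse (map f R)) (⊆∧length≤⇒↭
    (Unique-map-on (antitone-injective f-antitone) R!)
    (λ y∈ → let x , x∈R , eq = ∈-map⁻ f y∈ in subst (_∈ R) (sym eq) (f-∈ x∈R))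
    (≤-reflexive (sym (length-map f R))))
    where
    R! : Unique R
    R! with Unique-++⁻ʳ L word!
    ... | _ ∷ R! = R!

  perm′ : IsPermutation n (L ++ 1 ∷ R′)
  perm′ = ↭-trans (Perm.++⁺ˡ L (prep 1 R′↭R)) perm

  word word′ : Word
  word  = L ++ 1 ∷ R
  word′ = L ++ 1 ∷ R′

  rlm≡ : rlm word ≡ rlm word′
  rlm≡ = trans (rlm-split L perm) (sym (rlm-split L perm′))

  rlmin≡ : rlmin word ≡ lrmaxRight word′
  rlmin≡ = begin
    rlmin word           ≡⟨ rlmin-++-min L (proj₁ (min-bounds L perm)) 1<R ⟩
    suc (rlmin R)        ≡⟨ cong suc (lrmax-reverse-map R f-antitone (All.tabulate λ x∈R → <⇒≤ (All.lookup 1<R (f-∈ x∈R)))) ⟨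
    suc (lrmax 0 R′)     ≡⟨ lrmaxRight-split L perm′ ⟨
    lrmaxRight word′     ∎
    where
    open ≡-Reasoning
    1<R = proj₂ (min-bounds L perm)

  asc≡ : asc word ≡ asc word′
  asc≡ = begin
    asc word                          ≡⟨ asc-++-∷ L 1 R ⟩
    asc (L ++ [ 1 ]) + asc (1 ∷ R)    ≡⟨ cong (asc (L ++ [ 1 ]) +_) (asc-∷-min-cong R R′ (proj₂ (min-bounds L perm))
                                           (proj₂ (min-bounds L perm′)) (sym (↭-length R′↭R)) (sym (asc-reverse-map R f-antitone))) ⟩
    asc (L ++ [ 1 ]) + asc (1 ∷ R′)   ≡⟨ asc-++-∷ L 1 R′ ⟨
    asc word′                         ∎
    where open ≡-Reasoning

-- Equal images have equal `L`, hence the same complementation, which is injective on the support.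
cut-injective : ∀ {n} (c c′ : Cut n) → Cut.word′ c ≡ Cut.word′ c′ → Cut.word c ≡ Cut.word c′
cut-injective {n} c c′ eq = go (split-at-1-unique (L c) (L c′) (perm′ c) (perm′ c′) eq)
  where
  open Cut
  go : L c ≡ L c′ × R′ c ≡ R′ c′ → word c ≡ word c′
  go (L≡ , R′≡) = cong₂ (λ l r → l ++ 1 ∷ r) L≡ (map-injective-on (R c) (R c′)
    (antitone-injective (opposite-antitone n (L c))) (R⊆support c)
    (λ x∈ → subst (λ l → _ ∈ support n l) (sym L≡) (R⊆support c′ x∈))
    (trans (reverse-injective R′≡) (cong (λ l → map (opposite n l) (R c′)) (sym L≡))))

rlm-rlmin~rlm-lrmaxRight : ∀ n → EquallyDistributed (S (suc n)) (rlm ∷ rlmin ∷ asc ∷ []) (rlm ∷ lrmaxRight ∷ asc ∷ [])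
rlm-rlmin~rlm-lrmaxRight n = equallyDistributed-via (S-unique (suc n)) _ _ Cut.word Cut.word′
  (λ w∈S → let π = ∈-S⇒perm w∈S ; L , R , eq = split-at-1 π in
    record { L = L ; R = R ; perm = subst (IsPermutation (suc n)) eq π } , sym eq)
  (λ c → Equivalence.from (∈-S (suc n) _) (Cut.perm′ c))
  (λ {c} {c′} → cut-injective c c′)
  (λ c → ∷-cong₃ (Cut.rlm≡ c) (Cut.rlmin≡ c) (Cut.asc≡ c))

-- Exchanging the prefixes below the largest letter to the left of 1

-- Maximality of the prefix below `m`: when `m` does not occur, what remains is empty or begins
-- above `m`.
data StartsAbove (m : ℕ) : Word → Set where
  []  : StartsAbove m []
  _∷_ : ∀ {x} → m < x → ∀ w → StartsAbove m (x ∷ w)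

-- The first letter exceeds both bounds and becomes the new bound, which erases their difference.
lrmax-StartsAbove : ∀ {b m w} → b < m → StartsAbove m w → lrmax b w ≡ lrmax m w
lrmax-StartsAbove b<m [] = refl
lrmax-StartsAbove b<m (m<x ∷ w) = trans (lrmax-∷-> w (<-trans b<m m<x)) (sym (lrmax-∷-> w m<x))

max-split : ∀ x w → Unique (x ∷ w) → ∃[ A ] ∃[ m ] ∃[ C ] x ∷ w ≡ A ++ m ∷ C × All (_< m) A × All (_< m) C
max-split x [] _ = [] , x , [] , refl , [] , []
max-split x (y ∷ w) (x∉ ∷ w!) with max-split y w w!
... | A , m , C , eq , A<m , C<m with <-cmp x m
...   | tri< x<m _ _ = x ∷ A , m , C , cong (x ∷_) eq , x<m ∷ A<m , C<m
...   | tri≈ _ refl _ = contradiction refl (All.lookup x∉ (subst (x ∈_) (sym eq) (∈-++⁺ʳ A (here refl))))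
...   | tri> _ _ m<x = [] , x , y ∷ w , refl , [] , subst (All (_< x)) (sym eq)
        (All.++⁺ (All.map (λ z<m → <-trans z<m m<x) A<m) (m<x ∷ All.map (λ z<m → <-trans z<m m<x) C<m))

prefix-split : ∀ m w → m ∉ w → ∃[ B ] ∃[ D ] w ≡ B ++ D × All (_< m) B × StartsAbove m D
prefix-split m [] _ = [] , [] , refl , [] , []
prefix-split m (x ∷ w) m∉ with <-cmp x m
... | tri≈ _ refl _ = contradiction (here refl) m∉
... | tri> _ _ m<x = [] , x ∷ w , refl , [] , m<x ∷ w
... | tri< x<m _ _ with prefix-split m w (m∉ ∘ there)
...   | B , D , refl , B<m , D> = x ∷ B , D , refl , x<m ∷ B<m , D>

prefix-split-unique : ∀ {m} A {D} A′ {D′} → A ++ D ≡ A′ ++ D′ → All (_< m) A → All (_< m) A′ →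
  StartsAbove m D → StartsAbove m D′ → A ≡ A′ × D ≡ D′
prefix-split-unique [] [] eq _ _ _ _ = refl , eq
prefix-split-unique [] (x ∷ A′) refl _ (x<m ∷ _) (m<x ∷ _) _ = contradiction x<m (<-asym m<x)
prefix-split-unique (x ∷ A) [] refl (x<m ∷ _) _ _ (m<x ∷ _) = contradiction x<m (<-asym m<x)
prefix-split-unique (x ∷ A) (x′ ∷ A′) eq (_ ∷ A<m) (_ ∷ A′<m) D> D′> with ∷-injective eq
... | refl , eq′ with prefix-split-unique A A′ eq′ A<m A′<m D> D′>
...   | refl , D≡D′ = refl , D≡D′

-- Statistics of the words `A m C 1 B D`.

join : (A : Word) (m : ℕ) (C B D : Word) → Word
join A m C B D = (A ++ m ∷ C) ++ 1 ∷ B ++ D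

join-↭ : ∀ A m C B D → join A m C B D ↭ join B m C A D
join-↭ A m C B D = begin
  (A ++ m ∷ C) ++ 1 ∷ B ++ D      ≡⟨ regroup A (B ++ D) ⟩
  A ++ X ++ B ++ D                ↭⟨ Perm.++⁺ˡ A (Perm.shifts X B) ⟩
  A ++ B ++ X ++ D                ↭⟨ Perm.shifts A B ⟩
  B ++ A ++ X ++ D                ↭⟨ Perm.++⁺ˡ B (Perm.shifts A X) ⟩
  B ++ X ++ A ++ D                ≡⟨ regroup B (A ++ D) ⟨
  (B ++ m ∷ C) ++ 1 ∷ A ++ D      ∎
  where
  open PermutationReasoning
  X = m ∷ C ++ [ 1 ]
  regroup : ∀ A E → (A ++ m ∷ C) ++ 1 ∷ E ≡ A ++ X ++ E
  regroup A E = trans (++-assoc A (m ∷ C) (1 ∷ E)) (cong (A ++_) (sym (++-assoc (m ∷ C) [ 1 ] E)))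

-- The ascents of a word together with the one that enters its first letter from a smaller letter.
ascInto : Word → ℕ
ascInto []      = 0
ascInto (x ∷ w) = suc (asc (x ∷ w))

asc-++-StartsAbove : ∀ {m} x B {D} → All (_< m) (x ∷ B) → StartsAbove m D → asc (x ∷ B ++ D) ≡ asc (x ∷ B) + ascInto D
asc-++-StartsAbove x B <m [] = trans (cong (asc ∘ (x ∷_)) (++-identityʳ B)) (sym (+-identityʳ _))
asc-++-StartsAbove x B {y ∷ D} <m (m<y ∷ _) = begin
  asc (x ∷ B ++ y ∷ D)                   ≡⟨ asc-++-∷ (x ∷ B) y D ⟩
  asc (x ∷ B ++ [ y ]) + asc (y ∷ D)     ≡⟨ cong (_+ asc (y ∷ D)) (asc-∷ʳ-max x B (All.map (λ z<m → <-trans z<m m<y) <m)) ⟩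
  suc (asc (x ∷ B) + asc (y ∷ D))        ≡⟨ +-suc (asc (x ∷ B)) (asc (y ∷ D)) ⟨
  asc (x ∷ B) + suc (asc (y ∷ D))        ∎
  where open ≡-Reasoning

module _ {n} A m C B D (perm : IsPermutation n (join A m C B D))
         (A<m : All (_< m) A) (C<m : All (_< m) C) (B<m : All (_< m) B) (D> : StartsAbove m D) where

  private
    1<L = proj₁ (min-bounds (A ++ m ∷ C) perm)
    1<R = proj₂ (min-bounds (A ++ m ∷ C) perm)
    1<A = All.++⁻ˡ A 1<L
    1<m = All.head (All.++⁻ʳ A 1<L)
    1<B = All.++⁻ˡ B 1<R

  rlm-join : rlm (join A m C B D) ≡ suc (rlmax C)
  rlm-join = trans (rlm-split (A ++ m ∷ C) perm) (rlmax-++-max A A<m C<m)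

  -- After `m`, no letter of `C 1 B` is a left-to-right maximum, and `D` starts above `m`, so its
  -- maxima are those it has directly after `A`. The right part of the exchanged word is `A ++ D`.
  lrmax-join : lrmax 0 (join A m C B D) ≡ suc (lrmax 0 (A ++ D))
  lrmax-join = begin
    lrmax 0 (join A m C B D)                             ≡⟨ cong (lrmax 0) (++-assoc A (m ∷ C) (1 ∷ B ++ D)) ⟩
    lrmax 0 (A ++ m ∷ C ++ 1 ∷ B ++ D)                   ≡⟨ lrmax-++-max A _ (<-trans (s≤s z≤n) 1<m) A<m ⟩
    lrmax 0 A + suc (lrmax m (C ++ 1 ∷ B ++ D))          ≡⟨ cong (λ l → lrmax 0 A + suc l) (trans (lrmax-below C (1 ∷ B ++ D) C<m) (lrmax-below (1 ∷ B) D (1<m ∷ B<m))) ⟩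
    lrmax 0 A + suc (lrmax m D)                          ≡⟨ +-suc (lrmax 0 A) (lrmax m D) ⟩
    suc (lrmax 0 A + lrmax m D)                          ≡⟨ cong (λ l → suc (lrmax 0 A + l)) (lrmax-StartsAbove (maximum-< A (<-trans (s≤s z≤n) 1<m) A<m) D>) ⟨
    suc (lrmax 0 A + lrmax (maximum 0 A) D)              ≡⟨ cong suc (lrmax-++ 0 A D) ⟨
    suc (lrmax 0 (A ++ D))                               ∎
    where open ≡-Reasoning

  -- Both `A` followed by `m` and `B` preceded by 1 gain an ascent exactly if nonempty, which makes
  -- the sum symmetric in `A` and `B`.
  asc-join : asc (join A m C B D) ≡ asc (1 ∷ A) + (asc (m ∷ C ++ [ 1 ]) + (asc (1 ∷ B) + ascInto D))
  asc-join = begin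
    asc (join A m C B D)                                              ≡⟨ cong asc (++-assoc A (m ∷ C) (1 ∷ B ++ D)) ⟩
    asc (A ++ m ∷ C ++ 1 ∷ B ++ D)                                    ≡⟨ asc-++-∷ A m (C ++ 1 ∷ B ++ D) ⟩
    asc (A ++ [ m ]) + asc (m ∷ C ++ 1 ∷ B ++ D)                      ≡⟨ cong₂ _+_ (sym (asc-∷-min≡asc-∷ʳ-max 1<A A<m)) (asc-++-∷ (m ∷ C) 1 (B ++ D)) ⟩
    asc (1 ∷ A) + (asc (m ∷ C ++ [ 1 ]) + asc (1 ∷ B ++ D))           ≡⟨ cong (λ l → asc (1 ∷ A) + (asc (m ∷ C ++ [ 1 ]) + l)) (asc-++-StartsAbove 1 B (1<m ∷ B<m) D>) ⟩
    asc (1 ∷ A) + (asc (m ∷ C ++ [ 1 ]) + (asc (1 ∷ B) + ascInto D))  ∎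
    where open ≡-Reasoning

-- The case `none` has no letter before 1, hence no largest one, and the word is left fixed.
data MaxCut (n : ℕ) : Set where
  none : ∀ R → IsPermutation n (1 ∷ R) → MaxCut n
  some : ∀ A m C B D → IsPermutation n (join A m C B D) →
         All (_< m) A → All (_< m) C → All (_< m) B → StartsAbove m D → MaxCut n

unswapped swapped : ∀ {n} → MaxCut n → Word
unswapped (none R _)                 = 1 ∷ R
unswapped (some A m C B D _ _ _ _ _) = join A m C B D
swapped (none R _)                 = 1 ∷ R
swapped (some A m C B D _ _ _ _ _) = join B m C A D

unswapped-perm : ∀ {n} (c : MaxCut n) → IsPermutation n (unswapped c)
unswapped-perm (none R π)                 = π
unswapped-perm (some A m C B D π _ _ _ _) = π

swapped-perm : ∀ {n} (c : MaxCut n) → IsPermutation n (swapped c)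
swapped-perm (none R π)                 = π
swapped-perm (some A m C B D π _ _ _ _) = ↭-trans (join-↭ B m C A D) π

unswapped-surjective : ∀ {n} w → IsPermutation (suc n) w → ∃[ c ] unswapped {suc n} c ≡ w
unswapped-surjective {n} w π with split-at-1 π
... | [] , R , refl = none R π , refl
... | x ∷ L , R , refl with max-split x L (Unique-++⁻ˡ (x ∷ L) (perm⇒Unique π))
...   | A , m , C , eq , A<m , C<m with prefix-split m R m∉R
  where
  m∉R : m ∉ R
  m∉R m∈R = Unique-++⇒∉ (x ∷ L) (perm⇒Unique π) (subst (m ∈_) (sym eq) (∈-++⁺ʳ A (here refl))) (there m∈R)
...     | B , D , refl , B<m , D> =
  some A m C B D (subst (λ l → IsPermutation (suc n) (l ++ 1 ∷ B ++ D)) eq π) A<m C<m B<m D> , cong (_++ 1 ∷ B ++ D) (sym eq)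

-- The exchanged word has the same shape: `m` is again the largest letter before 1, and `A` is now
-- the longest prefix below `m` after it.
swapped-injective : ∀ {n} (c c′ : MaxCut n) → swapped c ≡ swapped c′ → unswapped c ≡ unswapped c′
swapped-injective (none R _) (none R′ _) eq = eq
swapped-injective c@(none R π) c′@(some A m C B D _ _ _ _ _) eq
  with split-at-1-unique [] (B ++ m ∷ C) π (swapped-perm c′) eq
-- The other word has `m` before 1, so its left part has positive length.
... | []≡ , _ = contradiction (cong length []≡) λ eq → <⇒≢ (m<m+n 0 (≤-trans (s≤s z≤n) (≤-trans (m≤n+m _ (length B)) (≤-reflexive (sym (length-++ B)))))) eq
swapped-injective c@(some _ _ _ _ _ _ _ _ _ _) c′@(none _ _) eq = sym (swapped-injective c′ c (sym eq))
swapped-injective c@(some A m C B D _ A<m C<m B<m D>) c′@(some A′ m′ C′ B′ D′ _ A′<m C′<m B′<m D′>) eq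
  with split-at-1-unique (B ++ m ∷ C) (B′ ++ m′ ∷ C′) (swapped-perm c) (swapped-perm c′) eq
... | eqˡ , eqʳ with max-split-unique B B′ eqˡ B<m C<m B′<m C′<m
... | refl , refl , refl with prefix-split-unique A A′ eqʳ A<m A′<m D> D′>
... | refl , refl = refl

rlm-swapped : ∀ {n} (c : MaxCut n) → rlm (unswapped c) ≡ rlm (swapped c)
rlm-swapped (none R _) = refl
rlm-swapped c@(some A m C B D π A<m C<m B<m D>) = trans
  (rlm-join A m C B D π A<m C<m B<m D>) (sym (rlm-join B m C A D (swapped-perm c) B<m C<m A<m D>))

lrmax-swapped : ∀ {n} (c : MaxCut n) → lrmax 0 (unswapped c) ≡ lrmaxRight (swapped c)
-- All letters of `R` exceed 1, so the bounds 0 and 1 give the same count on `R`.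
lrmax-swapped (none R π) = trans (lrmax-∷-> R (s≤s z≤n)) (cong suc (sym (lrmax-StartsAbove (s≤s z≤n) (above R (proj₂ (min-bounds [] π))))))
  where
  above : ∀ {m} w → All (m <_) w → StartsAbove m w
  above [] [] = []
  above (x ∷ w) (m<x ∷ _) = m<x ∷ w
lrmax-swapped c@(some A m C B D π A<m C<m B<m D>) = trans
  (lrmax-join A m C B D π A<m C<m B<m D>) (sym (lrmaxRight-split (B ++ m ∷ C) (swapped-perm c)))

asc-swapped : ∀ {n} (c : MaxCut n) → asc (unswapped c) ≡ asc (swapped c)
asc-swapped (none R _) = refl
asc-swapped c@(some A m C B D π A<m C<m B<m D>) = begin
  asc (join A m C B D)      ≡⟨ asc-join A m C B D π A<m C<m B<m D> ⟩
  a + (x + (b + t))         ≡⟨ solve 4 (λ a x b t → a :+ (x :+ (b :+ t)) := b :+ (x :+ (a :+ t))) refl a x b t ⟩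
  b + (x + (a + t))         ≡⟨ asc-join B m C A D (swapped-perm c) B<m C<m A<m D> ⟨
  asc (join B m C A D)      ∎
  where
  open ≡-Reasoning
  a = asc (1 ∷ A)
  b = asc (1 ∷ B)
  x = asc (m ∷ C ++ [ 1 ])
  t = ascInto D

rlm-wnm~rlm-lrmaxRight : ∀ n → EquallyDistributed (S (suc n)) (rlm ∷ wnm ∷ asc ∷ []) (rlm ∷ lrmaxRight ∷ asc ∷ [])
rlm-wnm~rlm-lrmaxRight n = equallyDistributed-via (S-unique (suc n)) _ _ unswapped swapped
  (λ {w} w∈S → unswapped-surjective w (∈-S⇒perm w∈S))
  (λ c → Equivalence.from (∈-S (suc n) _) (swapped-perm c))
  (λ {c} {c′} → swapped-injective c c′)
  (λ c → ∷-cong₃ (rlm-swapped c) (trans (wnm≡lrmax (unswapped c) (unswapped-perm c)) (lrmax-swapped c)) (asc-swapped c))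

-- Both equidistributions, through the triple with `lrmaxRight`.

theorem1p5 : (n : ℕ) → 1 ≤ n →
    EquallyDistributed (S n) (rlm ∷ wnm ∷ asc ∷ []) (rlmax-1 ∷ rlmin ∷ asc ∷ []) ×
    EquallyDistributed (S n) (rlm ∷ rlmin ∷ asc ∷ []) (rlmax-1 ∷ rlmin ∷ asc ∷ [])
theorem1p5 (suc n) _ =
  (λ a → trans (rlm-wnm~rlm-lrmaxRight n a) (sym (rlmax-rlmin~rlm-lrmaxRight n a))) ,
  (λ a → trans (rlm-rlmin~rlm-lrmaxRight n a) (sym (rlmax-rlmin~rlm-lrmaxRight n a)))
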